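{- Let $n\ge 2$ be an integer and let $\lambda\in[0,1]$. Then $$\sum_{j=0}^{n}\lambda^j-\sum_{k=1}^{n-1}\left\{M\left(\left[\frac{n-1}{k}\right]\right)\left(\sum_{j=0}^{n-k}\lambda^j\right)\right\}\ \ge\ 0,$$ and equality occurs if and only if $\lambda=0$.
   Context: Here $\mu$ denotes the Möbius function on the positive integers: $\mu(1)=1$; $\mu(m)=0$ if $m$ is divisible by the square of an integer greater than $1$; and $\mu(m)=(-1)^r$ if $m$ is the product of $r$ pairwise distinct primes. The Mertens function is $M(N)=\sum_{m=1}^{N}\mu(m)$ for positive integers $N$. For positive integers $a,k$ with $k\le a$, $\left[\frac{a}{k}\right]$ denotes the largest integer $j$ with $j\le \frac{a}{k}$ (the floor). The convention $\lambda^0=1$ is used, including at $\lambda=0$. -}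

module Defs where

open import Algebra.Bundles.Raw using (RawMonoid; RawRing)
import Algebra.Definitions.RawMonoid as RawMonoidOps
import Algebra.Definitions.RawSemiring as RawSemiringOps
open import Data.Fin.Base using (toℕ)
open import Data.Integer.Base as ℤ using (ℤ; 0ℤ; 1ℤ; -1ℤ)
open import Data.List.Base using (length)
open import Data.Nat.Base as ℕ using (ℕ; suc; NonZero)
open import Data.Nat.Divisibility using (_∣_; _∣?_)
open import Data.Nat.Primality.Factorisation using (factorise; factors)
import Data.Nat.Properties as ℕ
open import Data.Product.Base using (∃; _×_; _,_; proj₁; proj₂)
open import Data.Rational.Base as ℚ using (ℚ; 0ℚ; 1ℚ; ½; ∣_∣; 1/_)
import Data.Rational.Properties as ℚ
open import Data.Rational.Solver using (module +-*-Solver)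
open import Level using (0ℓ)
open import Relation.Binary.PropositionalEquality
  using (_≡_; refl; sym; trans; cong; subst)
open import Relation.Nullary.Decidable using (Dec; yes; no; _×-dec_)

------------------------------------------------------------------------
-- Möbius and Mertens functions

-- For m > 0 the bound d ≤ m excludes nothing; it only makes the search finite.
HasSquareDivisor : ℕ → Set
HasSquareDivisor m = ∃ λ d → d ℕ.< suc m × (1 ℕ.< d × d ℕ.* d ∣ m)

hasSquareDivisor? : ∀ m → Dec (HasSquareDivisor m)
hasSquareDivisor? m = ℕ.anyUpTo? (λ d → (1 ℕ.<? d) ×-dec (d ℕ.* d ∣? m)) (suc m)

-- In the second case the prime factors listed by `factorise` are pairwise
-- distinct, since a repeated one would give a square divisor.
μ : (m : ℕ) .{{_ : NonZero m}} → ℤ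
μ m with hasSquareDivisor? m
... | yes _ = 0ℤ
... | no  _ = -1ℤ ℤ.^ length (factors (factorise m))

module _ {c ℓ} (A : RawMonoid c ℓ) where
  open RawMonoid A using (Carrier)
  open RawMonoidOps A using (sum)

  sumFrom0 : ℕ → (ℕ → Carrier) → Carrier
  sumFrom0 n f = sum {suc n} λ i → f (toℕ i)

  sumFrom1 : ℕ → ((k : ℕ) .{{_ : NonZero k}} → Carrier) → Carrier
  sumFrom1 n f = sum {n} λ i → f (suc (toℕ i))

M : ℕ → ℤ
M N = sumFrom1 ℤ.+-0-rawMonoid N μ

------------------------------------------------------------------------
-- Real numbers as Cauchy sequences of rationals, with a setoid equality.
-- Cauchyness carries its modulus, so `_≤_` and `_≃_` are stable under
-- double negation and lose nothing against their classical readings.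

IsCauchy : (ℕ → ℚ) → Set
IsCauchy x = ∀ ε → 0ℚ ℚ.< ε →
  ∃ λ N → ∀ m n → N ℕ.≤ m → N ℕ.≤ n → ∣ x m ℚ.- x n ∣ ℚ.≤ ε

record ℝ : Set where
  constructor mkℝ
  field
    seq      : ℕ → ℚ
    isCauchy : IsCauchy seq

open ℝ public

infix 4 _≤_ _≃_

_≤_ : ℝ → ℝ → Set
x ≤ y = ∀ ε → 0ℚ ℚ.< ε → ∃ λ N → ∀ n → N ℕ.≤ n → seq x n ℚ.≤ seq y n ℚ.+ ε

_≃_ : ℝ → ℝ → Set
x ≃ y = ∀ ε → 0ℚ ℚ.< ε → ∃ λ N → ∀ n → N ℕ.≤ n → ∣ seq x n ℚ.- seq y n ∣ ℚ.≤ ε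

fromℚ : ℚ → ℝ
fromℚ q = mkℝ (λ _ → q) λ ε 0<ε → 0 , λ _ _ _ _ →
  ℚ.≤-trans (ℚ.≤-reflexive (cong ∣_∣ (ℚ.+-inverseʳ q))) (ℚ.<⇒≤ 0<ε)

fromℤ : ℤ → ℝ
fromℤ i = fromℚ (i ℚ./ 1)

0ℝ 1ℝ : ℝ
0ℝ = fromℚ 0ℚ
1ℝ = fromℚ 1ℚ

private
  +-cauchy : ∀ {x y} → IsCauchy x → IsCauchy y → IsCauchy (λ n → x n ℚ.+ y n)
  +-cauchy {x} {y} cx cy ε 0<ε = N₁ ℕ.⊔ N₂ , λ m n N≤m N≤n → begin
    ∣ (x m ℚ.+ y m) ℚ.- (x n ℚ.+ y n) ∣        ≡⟨ cong ∣_∣ (regroup (x m) (y m) (x n) (y n)) ⟩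
    ∣ (x m ℚ.- x n) ℚ.+ (y m ℚ.- y n) ∣        ≤⟨ ℚ.∣p+q∣≤∣p∣+∣q∣ (x m ℚ.- x n) (y m ℚ.- y n) ⟩
    ∣ x m ℚ.- x n ∣ ℚ.+ ∣ y m ℚ.- y n ∣        ≤⟨ ℚ.+-mono-≤
      (proj₂ (cx δ 0<δ) m n (ℕ.m⊔n≤o⇒m≤o N₁ N₂ N≤m) (ℕ.m⊔n≤o⇒m≤o N₁ N₂ N≤n))
      (proj₂ (cy δ 0<δ) m n (ℕ.m⊔n≤o⇒n≤o N₁ N₂ N≤m) (ℕ.m⊔n≤o⇒n≤o N₁ N₂ N≤n)) ⟩
    δ ℚ.+ δ                                    ≡⟨ halves ε ⟩
    ε                                          ∎
    where
    open ℚ.≤-Reasoning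
    δ : ℚ
    δ = ½ ℚ.* ε
    0<δ : 0ℚ ℚ.< δ
    0<δ = ℚ.*-monoʳ-<-pos ½ 0<ε
    N₁ N₂ : ℕ
    N₁ = proj₁ (cx δ 0<δ)
    N₂ = proj₁ (cy δ 0<δ)
    regroup : ∀ a b c d → (a ℚ.+ b) ℚ.- (c ℚ.+ d) ≡ (a ℚ.- c) ℚ.+ (b ℚ.- d)
    regroup = solve 4 (λ a b c d → (a :+ b) :- (c :+ d) := (a :- c) :+ (b :- d)) refl
      where open +-*-Solver
    halves : ∀ e → ½ ℚ.* e ℚ.+ ½ ℚ.* e ≡ e
    halves e = trans (sym (ℚ.*-distribʳ-+ e ½ ½)) (ℚ.*-identityˡ e)

  neg-cauchy : ∀ {x} → IsCauchy x → IsCauchy (λ n → ℚ.- x n)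
  neg-cauchy {x} cx ε 0<ε = proj₁ (cx ε 0<ε) , λ m n N≤m N≤n → begin
    ∣ ℚ.- x m ℚ.- ℚ.- x n ∣  ≡⟨ cong ∣_∣ (sym (ℚ.neg-distrib-+ (x m) (ℚ.- x n))) ⟩
    ∣ ℚ.- (x m ℚ.- x n) ∣    ≡⟨ ℚ.∣-p∣≡∣p∣ (x m ℚ.- x n) ⟩
    ∣ x m ℚ.- x n ∣          ≤⟨ proj₂ (cx ε 0<ε) m n N≤m N≤n ⟩
    ε                        ∎
    where open ℚ.≤-Reasoning

  eventuallyBounded : ∀ {x} → IsCauchy x →
    ∃ λ B → ℚ.Positive B × ∃ λ N → ∀ n → N ℕ.≤ n → ∣ x n ∣ ℚ.≤ B
  eventuallyBounded {x} cx = 1ℚ ℚ.+ ∣ x N ∣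
    , ℚ.pos+nonNeg⇒pos 1ℚ ∣ x N ∣ {{ℚ.∣-∣-nonNeg (x N)}}
    , N , λ n N≤n → begin
    ∣ x n ∣                        ≡⟨ cong ∣_∣ (split (x n) (x N)) ⟩
    ∣ (x n ℚ.- x N) ℚ.+ x N ∣      ≤⟨ ℚ.∣p+q∣≤∣p∣+∣q∣ (x n ℚ.- x N) (x N) ⟩
    ∣ x n ℚ.- x N ∣ ℚ.+ ∣ x N ∣    ≤⟨ ℚ.+-monoˡ-≤ ∣ x N ∣ (proj₂ (cx 1ℚ 0<1) n N N≤n ℕ.≤-refl) ⟩
    1ℚ ℚ.+ ∣ x N ∣                 ∎
    where
    open ℚ.≤-Reasoning
    0<1 : 0ℚ ℚ.< 1ℚ
    0<1 = ℚ.positive⁻¹ 1ℚ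
    N : ℕ
    N = proj₁ (cx 1ℚ 0<1)
    split : ∀ a b → a ≡ (a ℚ.- b) ℚ.+ b
    split = solve 2 (λ a b → a := (a :- b) :+ b) refl
      where open +-*-Solver

  shrink : ∀ K → ℚ.Positive K → ∀ ε → 0ℚ ℚ.< ε → ∃ λ δ → 0ℚ ℚ.< δ × K ℚ.* δ ≡ ε
  shrink K K>0 ε 0<ε = 1/K ℚ.* ε , 0<δ , K*δ≡ε
    where
    instance
      nonZero : ℚ.NonZero K
      nonZero = ℚ.pos⇒nonZero K {{K>0}}
    1/K : ℚ
    1/K = 1/ K
    0<δ : 0ℚ ℚ.< 1/K ℚ.* ε
    0<δ = subst (ℚ._< 1/K ℚ.* ε) (ℚ.*-zeroʳ 1/K)
      (ℚ.*-monoʳ-<-pos 1/K {{ℚ.1/pos⇒pos K {{K>0}}}} 0<ε)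
    K*δ≡ε : K ℚ.* (1/K ℚ.* ε) ≡ ε
    K*δ≡ε = trans (sym (ℚ.*-assoc K 1/K ε))
      (trans (cong (ℚ._* ε) (ℚ.*-inverseʳ K)) (ℚ.*-identityˡ ε))

  product≤ : ∀ a b {A δ} → ℚ.Positive A →
    ∣ a ∣ ℚ.≤ A → ∣ b ∣ ℚ.≤ δ → ∣ a ℚ.* b ∣ ℚ.≤ A ℚ.* δ
  product≤ a b {A} {δ} A>0 a≤A b≤δ = begin
    ∣ a ℚ.* b ∣      ≡⟨ ℚ.∣p*q∣≡∣p∣*∣q∣ a b ⟩
    ∣ a ∣ ℚ.* ∣ b ∣  ≤⟨ ℚ.*-monoʳ-≤-nonNeg ∣ b ∣ {{ℚ.∣-∣-nonNeg b}} a≤A ⟩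
    A ℚ.* ∣ b ∣      ≤⟨ ℚ.*-monoˡ-≤-nonNeg A {{ℚ.pos⇒nonNeg A {{A>0}}}} b≤δ ⟩
    A ℚ.* δ          ∎
    where open ℚ.≤-Reasoning

  productDifference≤ : ∀ a b c d {B C δ} → ℚ.Positive B → ℚ.Positive C →
    ∣ a ∣ ℚ.≤ B → ∣ d ∣ ℚ.≤ C → ∣ a ℚ.- c ∣ ℚ.≤ δ → ∣ b ℚ.- d ∣ ℚ.≤ δ →
    ∣ a ℚ.* b ℚ.- c ℚ.* d ∣ ℚ.≤ (B ℚ.+ C) ℚ.* δ
  productDifference≤ a b c d {B} {C} {δ} B>0 C>0 a≤B d≤C a-c b-d = begin
    ∣ a ℚ.* b ℚ.- c ℚ.* d ∣
      ≡⟨ cong ∣_∣ (cross a b c d) ⟩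
    ∣ a ℚ.* (b ℚ.- d) ℚ.+ d ℚ.* (a ℚ.- c) ∣
      ≤⟨ ℚ.∣p+q∣≤∣p∣+∣q∣ (a ℚ.* (b ℚ.- d)) (d ℚ.* (a ℚ.- c)) ⟩
    ∣ a ℚ.* (b ℚ.- d) ∣ ℚ.+ ∣ d ℚ.* (a ℚ.- c) ∣
      ≤⟨ ℚ.+-mono-≤ (product≤ a (b ℚ.- d) B>0 a≤B b-d) (product≤ d (a ℚ.- c) C>0 d≤C a-c) ⟩
    B ℚ.* δ ℚ.+ C ℚ.* δ
      ≡⟨ sym (ℚ.*-distribʳ-+ δ B C) ⟩
    (B ℚ.+ C) ℚ.* δ ∎
    where
    open ℚ.≤-Reasoning
    cross : ∀ a b c d → a ℚ.* b ℚ.- c ℚ.* d ≡ a ℚ.* (b ℚ.- d) ℚ.+ d ℚ.* (a ℚ.- c)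
    cross = solve 4 (λ a b c d → a :* b :- c :* d := a :* (b :- d) :+ d :* (a :- c)) refl
      where open +-*-Solver

  *-cauchy : ∀ {x y} → IsCauchy x → IsCauchy y → IsCauchy (λ n → x n ℚ.* y n)
  *-cauchy {x} {y} cx cy ε 0<ε =
    let B , B>0 , N₁ , x≤B = eventuallyBounded cx
        C , C>0 , N₂ , y≤C = eventuallyBounded cy
        δ , 0<δ , K*δ≡ε = shrink (B ℚ.+ C) (ℚ.pos+pos⇒pos B {{B>0}} C {{C>0}}) ε 0<ε
        N₃ , x-close = cx δ 0<δ
        N₄ , y-close = cy δ 0<δ
        N₁₂ = N₁ ℕ.⊔ N₂
        N₃₄ = N₃ ℕ.⊔ N₄
    in N₁₂ ℕ.⊔ N₃₄ , λ m n N≤m N≤n →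
      let N₃₄≤m = ℕ.m⊔n≤o⇒n≤o N₁₂ N₃₄ N≤m
          N₃₄≤n = ℕ.m⊔n≤o⇒n≤o N₁₂ N₃₄ N≤n
      in subst (∣ x m ℚ.* y m ℚ.- x n ℚ.* y n ∣ ℚ.≤_) K*δ≡ε
        (productDifference≤ (x m) (y m) (x n) (y n) B>0 C>0
          (x≤B m (ℕ.m⊔n≤o⇒m≤o N₁ N₂ (ℕ.m⊔n≤o⇒m≤o N₁₂ N₃₄ N≤m)))
          (y≤C n (ℕ.m⊔n≤o⇒n≤o N₁ N₂ (ℕ.m⊔n≤o⇒m≤o N₁₂ N₃₄ N≤n)))
          (x-close m n (ℕ.m⊔n≤o⇒m≤o N₃ N₄ N₃₄≤m) (ℕ.m⊔n≤o⇒m≤o N₃ N₄ N₃₄≤n))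
          (y-close m n (ℕ.m⊔n≤o⇒n≤o N₃ N₄ N₃₄≤m) (ℕ.m⊔n≤o⇒n≤o N₃ N₄ N₃₄≤n)))

infix  8 -_
infixl 7 _*_
infixl 6 _+_ _-_

_+_ _*_ : ℝ → ℝ → ℝ
x + y = mkℝ (λ n → seq x n ℚ.+ seq y n) (+-cauchy {seq x} {seq y} (isCauchy x) (isCauchy y))
x * y = mkℝ (λ n → seq x n ℚ.* seq y n) (*-cauchy {seq x} {seq y} (isCauchy x) (isCauchy y))

-_ : ℝ → ℝ
-_ x = mkℝ (λ n → ℚ.- seq x n) (neg-cauchy {seq x} (isCauchy x))

_-_ : ℝ → ℝ → ℝ
x - y = x + (- y)

ℝ-rawRing : RawRing 0ℓ 0ℓ
ℝ-rawRing = record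
  { Carrier = ℝ ; _≈_ = _≃_ ; _+_ = _+_ ; _*_ = _*_ ; -_ = -_ ; 0# = 0ℝ ; 1# = 1ℝ }

open RawSemiringOps (RawRing.rawSemiring ℝ-rawRing) public using (_^_)

infix 5 ∑₀ ∑₁

∑₀ : ℕ → (ℕ → ℝ) → ℝ
∑₀ = sumFrom0 (RawRing.+-rawMonoid ℝ-rawRing)

∑₁ : ℕ → ((k : ℕ) .{{_ : NonZero k}} → ℝ) → ℝ
∑₁ = sumFrom1 (RawRing.+-rawMonoid ℝ-rawRing)

syntax ∑₀ n (λ j → e) = ∑[ j =0⋯ n ] e
syntax ∑₁ n (λ k → e) = ∑[ k =1⋯ n ] e

module Submission where

-- Put N = n − 1, let S_m = 1 + λ + ⋯ + λ^m, and let P be the left-hand side of the inequality.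
-- For every f one has Σ_{k≤N} M([N/k]) f(k) = Σ_{i≤N} (μ ∗ f)(i), by induction on N. For constant f
-- this gives Σ_{k≤N} M([N/k]) = 1, hence P = Σ_{k≤N} M([N/k]) (S_n − S_{n−k}), which vanishes at
-- λ = 0. For λ > 0 put r = 1/λ ≥ 1; then S_n − S_{n−k} = f(k) with f(k) = λ^n (1 + r + ⋯ + r^(k−1)),
-- and all iterated differences of f are nonnegative. This property passes from f to k ↦ f(p k) and to
-- k ↦ f(p k) − f(k), and (μ ∗ f)(p i) is the value at i of the convolution of μ with the former
-- if p ∣ i and with the latter if p ∤ i. Peeling off the primes of i shows (μ ∗ f)(i) ≥ 0, so
-- P ≥ (μ ∗ f)(1) = λ^n.
--
-- A real number is handled through its rational approximations q: P is Lipschitz near [0, 1], so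
-- P(q) is close to P(c), where c is the point of [0, 1] nearest to q, and P(c) ≥ c^n.

import Algebra.Definitions.RawMonoid as RawMonoidOps
open import Algebra.Bundles.Raw using (RawRing)
open import Algebra.Properties.Group using (⁻¹-involutive)
open import Data.Fin.Base using (toℕ)
open import Data.Integer.Base as ℤ using (ℤ; 0ℤ; 1ℤ; -1ℤ)
import Data.Integer.Properties as ℤ
open import Data.List.Base using (length; _∷_)
open import Data.List.Relation.Unary.All using (All; []; _∷_)
open import Data.List.Relation.Binary.Permutation.Propositional.Properties using (↭-length)
open import Data.Nat.Base as ℕ using (ℕ; zero; suc; NonZero; s≤s; z≤n; _∸_; _/_; _%_)
open import Data.Nat.Coprimality as Coprime using (Coprime; coprime-divisor)
open import Data.Nat.DivMod
open import Data.Nat.Divisibility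
open import Data.Nat.ListAction using (product)
open import Data.Nat.Primality
open import Data.Nat.Primality.Factorisation
import Data.Nat.Properties as ℕ
open import Data.Product.Base using (∃; _×_; _,_)
open import Data.Rational.Base as ℚ using (ℚ; 0ℚ; 1ℚ; ½; 1/_; ∣_∣; toℚᵘ)
import Data.Rational.Properties as ℚ
open import Data.Rational.Solver using (module +-*-Solver)
open import Data.Rational.Unnormalised.Base as ℚᵘ using (mkℚᵘ; *≡*)
import Data.Rational.Unnormalised.Properties as ℚᵘ
open import Data.Sum.Base using (inj₁; inj₂)
open import Function.Base using (_∘_)
open import Function.Bundles using (_⇔_; mk⇔)
open import Relation.Binary.PropositionalEquality
open import Relation.Nullary.Decidable using (yes; no; toWitness)
open import Relation.Nullary.Negation using (contradiction)

module _ where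
  import Defs as ℝ
  open import Defs using
    (HasSquareDivisor; hasSquareDivisor?; μ; M; ℝ; seq; 0ℝ; 1ℝ; _≃_; ℝ-rawRing; fromℤ; ∑₀; ∑₁)
  open import Data.Rational.Base using (_+_; _*_; _-_; -_; _≤_; _<_; _⊓_; +-*-rawSemiring)
  open import Algebra.Definitions.RawSemiring +-*-rawSemiring using (_^_)

  -- The Möbius function at multiples of a prime

  prime>1 : ∀ {p} → Prime p → 1 ℕ.< p
  prime>1 {p} pp = ℕ.nonTrivial⇒n>1 p {{prime⇒nonTrivial pp}}

  ∤⇒coprime : ∀ {p d} → Prime p → p ∤ d → Coprime d p
  ∤⇒coprime pp p∤d (e∣d , e∣p) with prime⇒irreducible pp e∣p
  ... | inj₁ e≡1  = e≡1
  ... | inj₂ refl = contradiction e∣d p∤d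

  -- A common divisor of d and p² is coprime to p because it divides d; one factor p therefore
  -- cancels, and the previous lemma applies.
  ∤⇒coprime² : ∀ {p d} → Prime p → p ∤ d → Coprime d (p ℕ.* p)
  ∤⇒coprime² {p} {d} pp p∤d (e∣d , e∣p²) =
    ∤⇒coprime pp p∤d (e∣d , coprime-divisor (λ (c∣e , c∣p) → ∤⇒coprime pp p∤d (∣-trans c∣e e∣d , c∣p)) e∣p²)

  squareDivisor : ∀ {m d} .{{_ : NonZero m}} → 1 ℕ.< d → d ℕ.* d ∣ m → HasSquareDivisor m
  squareDivisor {m} {d} 1<d d²∣m = d , s≤s (∣⇒≤ (m*n∣⇒m∣ d d d²∣m)) , 1<d , d²∣m

  μ-square : ∀ {m d} .{{_ : NonZero m}} → 1 ℕ.< d → d ℕ.* d ∣ m → μ m ≡ 0ℤ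
  μ-square {m} 1<d d²∣m with hasSquareDivisor? m
  ... | yes _ = refl
  ... | no ¬s = contradiction (squareDivisor 1<d d²∣m) ¬s

  -- If p divided d, then p² would divide pm and p would divide m. So d² is coprime to p, and the
  -- factor p can be cancelled.
  squareDivisor-prime* : ∀ {p m} .{{_ : NonZero m}} → Prime p → p ∤ m →
    HasSquareDivisor (p ℕ.* m) → HasSquareDivisor m
  squareDivisor-prime* {p} {m} pp p∤m (d , _ , 1<d , d²∣pm) with p ∣? d
  ... | yes p∣d = contradiction
    (*-cancelˡ-∣ p {{prime⇒nonZero pp}} (∣-trans (*-pres-∣ p∣d p∣d) d²∣pm)) p∤m
  ... | no  p∤d = squareDivisor 1<d (coprime-divisor (∤⇒coprime pp p∤d²) d²∣pm)
    where
    p∤d² : p ∤ d ℕ.* d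
    p∤d² p∣d² with euclidsLemma d d pp p∣d²
    ... | inj₁ p∣d = p∤d p∣d
    ... | inj₂ p∣d = p∤d p∣d

  -- Unique factorisation: p followed by the factors of m is a factorisation of pm, hence a
  -- permutation of the computed one.
  length-factors-prime* : ∀ {p m} .{{_ : NonZero m}} .{{_ : NonZero (p ℕ.* m)}} → Prime p →
    length (factors (factorise (p ℕ.* m))) ≡ suc (length (factors (factorise m)))
  length-factors-prime* {p} {m} pp = ↭-length (factorisationUnique (factorise (p ℕ.* m)) (record
    { factors         = p ∷ factors (factorise m)
    ; isFactorisation = cong (p ℕ.*_) (isFactorisation (factorise m))
    ; factorsPrime    = pp ∷ factorsPrime (factorise m)
    }))
    where open PrimeFactorisation

  μ-prime* : ∀ {p m} .{{_ : NonZero m}} .{{_ : NonZero (p ℕ.* m)}} → Prime p → p ∤ m →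
    μ (p ℕ.* m) ≡ ℤ.- μ m
  μ-prime* {p} {m} pp p∤m with hasSquareDivisor? (p ℕ.* m) | hasSquareDivisor? m
  ... | yes _  | yes _ = refl
  ... | yes s  | no ¬s = contradiction (squareDivisor-prime* pp p∤m s) ¬s
  ... | no ¬s  | yes (d , _ , 1<d , d²∣m) =
    contradiction (squareDivisor 1<d (∣n⇒∣m*n p d²∣m)) ¬s
  ... | no  _  | no  _ = trans
    (cong (-1ℤ ℤ.^_) (length-factors-prime* {p} {m} pp))
    (ℤ.-1*i≡-i (-1ℤ ℤ.^ length (factors (factorise m))))

  -- Finite sums

  ι : ℤ → ℚ
  ι i = i ℚ./ 1

  ι-+ : ∀ i j → ι (i ℤ.+ j) ≡ ι i + ι j
  ι-+ i j = ℚ.toℚᵘ-injective (begin-equality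
    toℚᵘ (ι (i ℤ.+ j))            ≃⟨ ℚ.toℚᵘ-fromℚᵘ (mkℚᵘ (i ℤ.+ j) 0) ⟩
    mkℚᵘ (i ℤ.+ j) 0
      ≃⟨ *≡* (cong (ℤ._* 1ℤ) (cong₂ ℤ._+_ (ℤ.*-identityʳ i) (ℤ.*-identityʳ j))) ⟨
    mkℚᵘ i 0 ℚᵘ.+ mkℚᵘ j 0
      ≃⟨ ℚᵘ.+-cong (ℚ.toℚᵘ-fromℚᵘ (mkℚᵘ i 0)) (ℚ.toℚᵘ-fromℚᵘ (mkℚᵘ j 0)) ⟨
    toℚᵘ (ι i) ℚᵘ.+ toℚᵘ (ι j)    ≃⟨ ℚ.toℚᵘ-homo-+ (ι i) (ι j) ⟨
    toℚᵘ (ι i + ι j)              ∎)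
    where open ℚᵘ.≤-Reasoning

  ι-neg : ∀ i → ι (ℤ.- i) ≡ - ι i
  ι-neg (ℤ.+ zero)    = refl
  ι-neg (ℤ.+ (suc n)) = refl
  ι-neg ℤ.-[1+ n ]    = sym (⁻¹-involutive ℚ.+-0-group (ι (ℤ.+ suc n)))

  -- The last term is split off, so that enlarging the range by one adds a summand definitionally;
  -- `Σ<-head` splits at the other end, where the library sums recurse.
  Σ< : ℕ → (ℕ → ℚ) → ℚ
  Σ< zero    f = 0ℚ
  Σ< (suc n) f = Σ< n f + f n

  module _ where
    open ≡-Reasoning

    Σ<-cong : ∀ {f g} n → (∀ k → k ℕ.< n → f k ≡ g k) → Σ< n f ≡ Σ< n g
    Σ<-cong zero    f≡g = refl
    Σ<-cong (suc n) f≡g =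
      cong₂ _+_ (Σ<-cong n λ k k<n → f≡g k (ℕ.m<n⇒m<1+n k<n)) (f≡g n ℕ.≤-refl)

    Σ<-+ : ∀ f g n → Σ< n (λ k → f k + g k) ≡ Σ< n f + Σ< n g
    Σ<-+ f g zero    = refl
    Σ<-+ f g (suc n) = trans (cong (_+ (f n + g n)) (Σ<-+ f g n))
      (solve 4 (λ a b c d → (a :+ b) :+ (c :+ d) := (a :+ c) :+ (b :+ d)) refl
        (Σ< n f) (Σ< n g) (f n) (g n))
      where open +-*-Solver

    Σ<-neg : ∀ f n → Σ< n (λ k → - f k) ≡ - Σ< n f
    Σ<-neg f zero    = refl
    Σ<-neg f (suc n) =
      trans (cong (_+ - f n) (Σ<-neg f n)) (sym (ℚ.neg-distrib-+ (Σ< n f) (f n)))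

    Σ<-++ : ∀ f m n → Σ< (m ℕ.+ n) f ≡ Σ< m f + Σ< n (λ k → f (m ℕ.+ k))
    Σ<-++ f m zero    rewrite ℕ.+-identityʳ m = sym (ℚ.+-identityʳ (Σ< m f))
    Σ<-++ f m (suc n) rewrite ℕ.+-suc m n =
      trans (cong (_+ f (m ℕ.+ n)) (Σ<-++ f m n)) (ℚ.+-assoc (Σ< m f) _ _)

    Σ<-zero : ∀ {f} n → (∀ k → k ℕ.< n → f k ≡ 0ℚ) → Σ< n f ≡ 0ℚ
    Σ<-zero zero    f≡0 = refl
    Σ<-zero (suc n) f≡0 =
      cong₂ _+_ (Σ<-zero n λ k k<n → f≡0 k (ℕ.m<n⇒m<1+n k<n)) (f≡0 n ℕ.≤-refl)

    Σ<-head : ∀ f n → Σ< (suc n) f ≡ f 0 + Σ< n (λ k → f (suc k))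
    Σ<-head f n = trans (Σ<-++ f 1 n) (cong (_+ Σ< n (λ k → f (suc k))) (ℚ.+-identityˡ (f 0)))

    Σ<-support : ∀ {f} {m n} → m ℕ.≤ n → (∀ k → m ℕ.≤ k → k ℕ.< n → f k ≡ 0ℚ) → Σ< n f ≡ Σ< m f
    Σ<-support {f} {m} {n} m≤n f≡0 with d , refl ← ℕ.m≤n⇒∃[o]m+o≡n m≤n = begin
      Σ< (m ℕ.+ d) f                        ≡⟨ Σ<-++ f m d ⟩
      Σ< m f + Σ< d (λ k → f (m ℕ.+ k))     ≡⟨ cong (Σ< m f +_) (Σ<-zero d λ k k<d →
        f≡0 (m ℕ.+ k) (ℕ.m≤m+n m k) (ℕ.+-monoʳ-< m k<d)) ⟩
      Σ< m f + 0ℚ                           ≡⟨ ℚ.+-identityʳ (Σ< m f) ⟩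
      Σ< m f                                ∎

    -- Cut the range into blocks of p consecutive indices: only the first index of each block
    -- contributes.
    Σ<-multiples : ∀ {f} p .{{_ : NonZero p}} → (∀ k → p ∤ k → f k ≡ 0ℚ) →
      ∀ n → Σ< (n ℕ.* p) f ≡ Σ< n (λ k → f (k ℕ.* p))
    Σ<-multiples p f≡0 zero = refl
    Σ<-multiples {f} p@(suc _) f≡0 (suc n) = begin
      Σ< (p ℕ.+ n ℕ.* p) f                                      ≡⟨ cong (λ s → Σ< s f) (ℕ.+-comm p (n ℕ.* p)) ⟩
      Σ< (n ℕ.* p ℕ.+ p) f                                      ≡⟨ Σ<-++ f (n ℕ.* p) p ⟩
      Σ< (n ℕ.* p) f + Σ< p (λ k → f (n ℕ.* p ℕ.+ k))
        ≡⟨ cong₂ _+_ (Σ<-multiples p f≡0 n) (Σ<-support (s≤s z≤n) nonmultiple) ⟩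
      Σ< n (λ k → f (k ℕ.* p)) + (0ℚ + f (n ℕ.* p ℕ.+ 0))       ≡⟨ cong (Σ< n (λ k → f (k ℕ.* p)) +_)
        (trans (ℚ.+-identityˡ _) (cong f (ℕ.+-identityʳ (n ℕ.* p)))) ⟩
      Σ< n (λ k → f (k ℕ.* p)) + f (n ℕ.* p)                    ∎
      where
      nonmultiple : ∀ k → 1 ℕ.≤ k → k ℕ.< p → f (n ℕ.* p ℕ.+ k) ≡ 0ℚ
      nonmultiple k@(suc _) _ k<p = f≡0 (n ℕ.* p ℕ.+ k) λ p∣ →
        ℕ.<⇒≱ k<p (∣⇒≤ (∣m+n∣m⇒∣n p∣ (n∣m*n n)))

  -- Dirichlet convolution with the Möbius function

  -- The value at 0 is a filler that makes the function total.
  mob : ℕ → ℚ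
  mob zero      = 0ℚ
  mob m@(suc _) = ι (μ m)

  mob-square : ∀ m {d} → 1 ℕ.< d → d ℕ.* d ∣ m → mob m ≡ 0ℚ
  mob-square zero      1<d d²∣m = refl
  mob-square m@(suc _) 1<d d²∣m = cong ι (μ-square {m} 1<d d²∣m)

  mob-prime* : ∀ {p} m → Prime p → p ∤ m → mob (p ℕ.* m) ≡ - mob m
  mob-prime* {p}         zero      pp p∤m = contradiction (p ∣0) p∤m
  mob-prime* {p@(suc _)} m@(suc _) pp p∤m = trans (cong ι (μ-prime* {p} {m} pp p∤m)) (ι-neg (μ m))

  product≢0⇒factor≢0 : ∀ {i} q {k} .{{_ : NonZero i}} → i ≡ q ℕ.* k → NonZero k
  product≢0⇒factor≢0 q refl = ℕ.m*n≢0⇒n≢0 q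

  -- μ(i/k), extended by zero to the k that do not divide i.
  cofactor : ℕ → ℕ → ℚ
  cofactor k i with k ∣? i
  ... | yes k∣i = mob (quotient k∣i)
  ... | no  _   = 0ℚ

  -- As i is nonzero, so is k, and the quotient found by the divisibility test can only be q.
  cofactor-quotient : ∀ {k i} q .{{_ : NonZero i}} → i ≡ q ℕ.* k → cofactor k i ≡ mob q
  cofactor-quotient {k} {i} q i≡qk with k ∣? i
  ... | no k∤i               = contradiction (divides q i≡qk) k∤i
  ... | yes (divides r i≡rk) =
    cong mob (ℕ.*-cancelʳ-≡ r q k {{product≢0⇒factor≢0 q i≡qk}} (trans (sym i≡rk) i≡qk))

  cofactor-∤ : ∀ {k i} → k ∤ i → cofactor k i ≡ 0ℚ
  cofactor-∤ {k} {i} k∤i with k ∣? i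
  ... | no _    = refl
  ... | yes k∣i = contradiction k∣i k∤i

  cofactor-cancel : ∀ k i p .{{_ : NonZero i}} .{{_ : NonZero p}} →
    cofactor (k ℕ.* p) (i ℕ.* p) ≡ cofactor k i
  cofactor-cancel k i p with k ∣? i
  ... | no k∤i             = cofactor-∤ (k∤i ∘ *-cancelʳ-∣ p)
  ... | yes (divides q eq) = cofactor-quotient q {{ℕ.m*n≢0 i p}}
    (trans (cong (ℕ._* p) eq) (ℕ.*-assoc q k p))

  -- p² divides ip and is coprime to k, so it divides the quotient, where the Möbius function then
  -- vanishes.
  cofactor-prime²* : ∀ {k i p} .{{_ : NonZero i}} → Prime p → p ∣ i → p ∤ k →
    cofactor k (i ℕ.* p) ≡ 0ℚ
  cofactor-prime²* {k} {i} {p} pp p∣i p∤k with k ∣? (i ℕ.* p)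
  ... | no _               = refl
  ... | yes (divides q eq) = mob-square q (prime>1 pp)
    (coprime-divisor p²⊥k (subst (p ℕ.* p ∣_) (trans eq (ℕ.*-comm q k)) (*-monoˡ-∣ p p∣i)))
    where
    p²⊥k : Coprime (p ℕ.* p) k
    p²⊥k = Coprime.sym (∤⇒coprime² pp p∤k)

  -- The quotient acquires one new prime factor p, which flips the sign; a k prime to p that does
  -- not divide i does not divide ip either.
  cofactor-prime* : ∀ {k i p} .{{_ : NonZero i}} → Prime p → p ∤ i → p ∤ k →
    cofactor k (i ℕ.* p) ≡ - cofactor k i
  cofactor-prime* {k} {i} {p} pp p∤i p∤k with k ∣? i
  ... | no k∤i             = cofactor-∤ λ k∣ip →
    k∤i (coprime-divisor (∤⇒coprime pp p∤k) (subst (k ∣_) (ℕ.*-comm i p) k∣ip))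
  ... | yes (divides q eq) = trans
    (cofactor-quotient (p ℕ.* q) {{ip≢0}} (begin
      i ℕ.* p           ≡⟨ ℕ.*-comm i p ⟩
      p ℕ.* i           ≡⟨ cong (p ℕ.*_) eq ⟩
      p ℕ.* (q ℕ.* k)   ≡⟨ ℕ.*-assoc p q k ⟨
      p ℕ.* q ℕ.* k     ∎))
    (mob-prime* q pp (p∤i ∘ subst (p ∣_) (sym eq) ∘ ∣m⇒∣m*n k))
    where
    open ≡-Reasoning
    ip≢0 : NonZero (i ℕ.* p)
    ip≢0 = ℕ.m*n≢0 i p
      where instance _ = prime⇒nonZero pp

  -- The Dirichlet convolution (μ ∗ f)(i); for i > 0 the summand at k = 0 vanishes.
  convolve : ℕ → (ℕ → ℚ) → ℚ
  convolve i f = Σ< (suc i) λ k → f k * cofactor k i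

  -- No k beyond i divides i. This brings convolutions at different arguments to a common range.
  convolve-support : ∀ f i n .{{_ : NonZero i}} → suc i ℕ.≤ n →
    Σ< n (λ k → f k * cofactor k i) ≡ convolve i f
  convolve-support f i n i<n = Σ<-support i<n λ k i<k _ →
    trans (cong (f k *_) (cofactor-∤ (>⇒∤ i<k))) (ℚ.*-zeroʳ (f k))

  multiplesOf : ℕ → (ℕ → ℚ) → ℕ → ℚ
  multiplesOf p f k with p ∣? k
  ... | yes _ = f k
  ... | no  _ = 0ℚ

  multiplesOf-∣ : ∀ {p} f {k} → p ∣ k → multiplesOf p f k ≡ f k
  multiplesOf-∣ {p} f {k} p∣k with p ∣? k
  ... | yes _  = refl
  ... | no p∤k = contradiction p∣k p∤k

  multiplesOf-∤ : ∀ {p} f {k} → p ∤ k → multiplesOf p f k ≡ 0ℚ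
  multiplesOf-∤ {p} f {k} p∤k with p ∣? k
  ... | yes p∣k = contradiction p∣k p∤k
  ... | no _    = refl

  Σ<-convolve-multiples : ∀ (f : ℕ → ℚ) i p .{{_ : NonZero i}} .{{_ : NonZero p}} →
    Σ< (suc i) (λ k → f (k ℕ.* p) * cofactor (k ℕ.* p) (i ℕ.* p)) ≡ convolve i (λ k → f (k ℕ.* p))
  Σ<-convolve-multiples f i p = Σ<-cong (suc i) λ k _ → cong (λ c → f (k ℕ.* p) * c) (cofactor-cancel k i p)

  module _ {p : ℕ} (pp : Prime p) (f : ℕ → ℚ) (i : ℕ) .{{i≢0 : NonZero i}} where
    open ≡-Reasoning

    private
      instance
        p≢0 : NonZero p
        p≢0 = prime⇒nonZero pp

        ip≢0 : NonZero (i ℕ.* p)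
        ip≢0 = ℕ.m*n≢0 i p

      term : ℕ → ℚ
      term k = f k * cofactor k (i ℕ.* p)

      -- The range is enlarged to `suc i` full blocks of length p, as `Σ<-multiples` requires.
      bound : suc (i ℕ.* p) ℕ.≤ suc i ℕ.* p
      bound = ℕ.+-monoˡ-≤ (i ℕ.* p) (ℕ.<⇒≤ (prime>1 pp))

    -- Only multiples of p survive, and for these the factor p cancels in the quotient.
    convolve-prime²* : p ∣ i → convolve (i ℕ.* p) f ≡ convolve i (λ k → f (k ℕ.* p))
    convolve-prime²* p∣i = begin
      convolve (i ℕ.* p) f                      ≡⟨ convolve-support f (i ℕ.* p) (suc i ℕ.* p) bound ⟨
      Σ< (suc i ℕ.* p) term                     ≡⟨ Σ<-multiples p (λ k p∤k →
        trans (cong (f k *_) (cofactor-prime²* pp p∣i p∤k)) (ℚ.*-zeroʳ (f k))) (suc i) ⟩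
      Σ< (suc i) (λ k → term (k ℕ.* p))         ≡⟨ Σ<-convolve-multiples f i p ⟩
      convolve i (λ k → f (k ℕ.* p))            ∎

    -- The multiples of p give the first convolution; the other k have their sign flipped and give
    -- the second.
    convolve-prime* : p ∤ i →
      convolve (i ℕ.* p) f ≡ convolve i (λ k → f (k ℕ.* p)) - convolve i f
    convolve-prime* p∤i = begin
      convolve (i ℕ.* p) f                      ≡⟨ convolve-support f (i ℕ.* p) (suc i ℕ.* p) bound ⟨
      Σ< (suc i ℕ.* p) term                     ≡⟨ Σ<-cong (suc i ℕ.* p) (λ k _ → split k) ⟩
      Σ< (suc i ℕ.* p) (λ k → multiplesOf p term k + - (f k * cofactor k i))
        ≡⟨ Σ<-+ (multiplesOf p term) (λ k → - (f k * cofactor k i)) (suc i ℕ.* p) ⟩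
      Σ< (suc i ℕ.* p) (multiplesOf p term) + Σ< (suc i ℕ.* p) (λ k → - (f k * cofactor k i))
        ≡⟨ cong₂ _+_ multiples nonmultiples ⟩
      convolve i (λ k → f (k ℕ.* p)) - convolve i f ∎
      where
      -- The subtracted term can be written for every k: a multiple of p does not divide i, so there
      -- it is zero.
      split : ∀ k → term k ≡ multiplesOf p term k + - (f k * cofactor k i)
      split k with p ∣? k
      ... | yes p∣k = sym (begin
        term k + - (f k * cofactor k i)
          ≡⟨ cong (λ c → term k + - (f k * c)) (cofactor-∤ (p∤i ∘ ∣-trans p∣k)) ⟩
        term k + - (f k * 0ℚ)             ≡⟨ cong (λ c → term k + - c) (ℚ.*-zeroʳ (f k)) ⟩
        term k + 0ℚ                       ≡⟨ ℚ.+-identityʳ (term k) ⟩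
        term k                            ∎)
      ... | no p∤k = begin
        f k * cofactor k (i ℕ.* p)        ≡⟨ cong (f k *_) (cofactor-prime* pp p∤i p∤k) ⟩
        f k * - cofactor k i              ≡⟨ ℚ.neg-distribʳ-* (f k) (cofactor k i) ⟨
        - (f k * cofactor k i)            ≡⟨ ℚ.+-identityˡ _ ⟨
        0ℚ + - (f k * cofactor k i)       ∎

      multiples : Σ< (suc i ℕ.* p) (multiplesOf p term) ≡ convolve i (λ k → f (k ℕ.* p))
      multiples = begin
        Σ< (suc i ℕ.* p) (multiplesOf p term)
          ≡⟨ Σ<-multiples p (λ k → multiplesOf-∤ term) (suc i) ⟩
        Σ< (suc i) (λ k → multiplesOf p term (k ℕ.* p))
          ≡⟨ Σ<-cong (suc i) (λ k _ → multiplesOf-∣ term (n∣m*n k)) ⟩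
        Σ< (suc i) (λ k → term (k ℕ.* p))               ≡⟨ Σ<-convolve-multiples f i p ⟩
        convolve i (λ k → f (k ℕ.* p))                  ∎

      nonmultiples : Σ< (suc i ℕ.* p) (λ k → - (f k * cofactor k i)) ≡ - convolve i f
      nonmultiples = trans (Σ<-neg (λ k → f k * cofactor k i) (suc i ℕ.* p))
        (cong -_ (convolve-support f i (suc i ℕ.* p) (ℕ.≤-trans (s≤s (ℕ.m≤m*n i p)) bound)))

  convolve-1 : ∀ f → convolve 1 f ≡ f 1
  convolve-1 f = begin
    0ℚ + f 0 * 0ℚ + f 1 * 1ℚ   ≡⟨ cong₂ _+_ (cong (0ℚ +_) (ℚ.*-zeroʳ (f 0))) (ℚ.*-identityʳ (f 1)) ⟩
    0ℚ + f 1                   ≡⟨ ℚ.+-identityˡ (f 1) ⟩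
    f 1                        ∎
    where open ≡-Reasoning

  -- Used with a Q that quantifies over the convolved function or constant, because peeling off a
  -- prime changes the function.
  prime-induction : (Q : ℕ → Set) → Q 1 →
    (∀ {p} i .{{_ : NonZero i}} → Prime p → Q i → Q (i ℕ.* p)) →
    ∀ i .{{_ : NonZero i}} → Q i
  prime-induction Q Q1 Qp i =
    subst Q (sym (isFactorisation (factorise i))) (fromPrimes (factorsPrime (factorise i)))
    where
    open PrimeFactorisation
    fromPrimes : ∀ {ps} → All Prime ps → Q (product ps)
    fromPrimes []                    = Q1
    fromPrimes {p ∷ ps} (pp ∷ pps) = subst Q (ℕ.*-comm (product ps) p)
      (Qp (product ps) {{productOfPrimes≢0 pps}} pp (fromPrimes pps))

  -- Dilation leaves a constant unchanged. So the convolution cancels if p is new in i; if p divides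
  -- i, then i > 1 and the induction hypothesis applies.
  convolve-constant : ∀ i .{{_ : NonZero i}} → 1 ℕ.< i → ∀ c → convolve i (λ _ → c) ≡ 0ℚ
  convolve-constant = prime-induction (λ i → 1 ℕ.< i → ∀ c → convolve i (λ _ → c) ≡ 0ℚ)
    (λ { (s≤s ()) }) step
    where
    step : ∀ {p} i .{{_ : NonZero i}} → Prime p →
      (1 ℕ.< i → ∀ c → convolve i (λ _ → c) ≡ 0ℚ) →
      1 ℕ.< i ℕ.* p → ∀ c → convolve (i ℕ.* p) (λ _ → c) ≡ 0ℚ
    step {p} i pp ih _ c with p ∣? i
    ... | yes p∣i = trans (convolve-prime²* pp (λ _ → c) i p∣i)
      (ih (ℕ.<-≤-trans (prime>1 pp) (∣⇒≤ p∣i)) c)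
    ... | no p∤i  = trans (convolve-prime* pp (λ _ → c) i p∤i) (ℚ.+-inverseʳ (convolve i (λ _ → c)))

  -- Absolutely monotone sequences

  0≤+ : ∀ {p q} → 0ℚ ≤ p → 0ℚ ≤ q → 0ℚ ≤ p + q
  0≤+ = ℚ.+-mono-≤

  0≤* : ∀ {p q} → 0ℚ ≤ p → 0ℚ ≤ q → 0ℚ ≤ p * q
  0≤* {p} {q} 0≤p 0≤q = ℚ.nonNegative⁻¹ (p * q)
    {{ℚ.nonNeg*nonNeg⇒nonNeg p {{ℚ.nonNegative 0≤p}} q {{ℚ.nonNegative 0≤q}}}}

  p≤q⇒0≤q-p : ∀ {p q} → p ≤ q → 0ℚ ≤ q - p
  p≤q⇒0≤q-p {p} {q} p≤q = subst (_≤ q - p) (ℚ.+-inverseʳ p) (ℚ.+-monoˡ-≤ (- p) p≤q)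

  Σ<-nonNeg : ∀ {f} n → (∀ k → 0ℚ ≤ f k) → 0ℚ ≤ Σ< n f
  Σ<-nonNeg zero    0≤f = ℚ.≤-refl
  Σ<-nonNeg (suc n) 0≤f = 0≤+ (Σ<-nonNeg n 0≤f) (0≤f n)

  -- The first n iterated differences of f are nonnegative. Each difference is a witness that is
  -- specified pointwise, so that no function extensionality is needed.
  AbsMonotone : ℕ → (ℕ → ℚ) → Set
  AbsMonotone zero    f = ∀ k → 0ℚ ≤ f k
  AbsMonotone (suc n) f =
    (∀ k → 0ℚ ≤ f k) × ∃ λ Δf → AbsMonotone n Δf × (∀ k → f (suc k) ≡ f k + Δf k)

  absMonotone-nonNeg : ∀ n {f} → AbsMonotone n f → ∀ k → 0ℚ ≤ f k
  absMonotone-nonNeg zero    0≤f       = 0≤f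
  absMonotone-nonNeg (suc n) (0≤f , _) = 0≤f

  absMonotone-pred : ∀ n {f} → AbsMonotone (suc n) f → AbsMonotone n f
  absMonotone-pred zero    (0≤f , _)                 = 0≤f
  absMonotone-pred (suc n) (0≤f , Δf , Δf-am , f≡)   = 0≤f , Δf , absMonotone-pred n Δf-am , f≡

  absMonotone-resp : ∀ n {f g} → (∀ k → f k ≡ g k) → AbsMonotone n f → AbsMonotone n g
  absMonotone-resp zero    f≡g 0≤f k = subst (0ℚ ≤_) (f≡g k) (0≤f k)
  absMonotone-resp (suc n) f≡g (0≤f , Δf , Δf-am , f≡) =
    (λ k → subst (0ℚ ≤_) (f≡g k) (0≤f k)) , Δf , Δf-am ,
    λ k → trans (sym (f≡g (suc k))) (trans (f≡ k) (cong (_+ Δf k) (f≡g k)))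

  absMonotone-+ : ∀ n {f g} → AbsMonotone n f → AbsMonotone n g → AbsMonotone n (λ k → f k + g k)
  absMonotone-+ zero    0≤f 0≤g k = 0≤+ (0≤f k) (0≤g k)
  absMonotone-+ (suc n) {f} {g} (0≤f , Δf , Δf-am , f≡) (0≤g , Δg , Δg-am , g≡) =
    (λ k → 0≤+ (0≤f k) (0≤g k)) , (λ k → Δf k + Δg k) , absMonotone-+ n Δf-am Δg-am ,
    λ k → trans (cong₂ _+_ (f≡ k) (g≡ k))
      (solve 4 (λ a b c d → (a :+ b) :+ (c :+ d) := (a :+ c) :+ (b :+ d)) refl
        (f k) (Δf k) (g k) (Δg k))
    where open +-*-Solver

  absMonotone-0 : ∀ n → AbsMonotone n (λ _ → 0ℚ)
  absMonotone-0 zero    k = ℚ.≤-refl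
  absMonotone-0 (suc n) = (λ k → ℚ.≤-refl) , (λ _ → 0ℚ) , absMonotone-0 n , λ k → refl

  absMonotone-Σ< : ∀ n {f : ℕ → ℕ → ℚ} m → (∀ s → AbsMonotone n (f s)) →
    AbsMonotone n (λ k → Σ< m (λ s → f s k))
  absMonotone-Σ< n zero    f-am = absMonotone-0 n
  absMonotone-Σ< n (suc m) f-am = absMonotone-+ n (absMonotone-Σ< n m f-am) (f-am m)

  telescope : ∀ (f Δf : ℕ → ℚ) → (∀ k → f (suc k) ≡ f k + Δf k) →
    ∀ k m → f (k ℕ.+ m) ≡ f k + Σ< m (λ s → Δf (k ℕ.+ s))
  telescope f Δf f≡ k zero = trans (cong f (ℕ.+-identityʳ k)) (sym (ℚ.+-identityʳ (f k)))
  telescope f Δf f≡ k (suc m) = begin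
    f (k ℕ.+ suc m)                                                ≡⟨ cong f (ℕ.+-suc k m) ⟩
    f (suc (k ℕ.+ m))                                              ≡⟨ f≡ (k ℕ.+ m) ⟩
    f (k ℕ.+ m) + Δf (k ℕ.+ m)
      ≡⟨ cong (_+ Δf (k ℕ.+ m)) (telescope f Δf f≡ k m) ⟩
    f k + Σ< m (λ s → Δf (k ℕ.+ s)) + Δf (k ℕ.+ m)                 ≡⟨ ℚ.+-assoc (f k) _ _ ⟩
    f k + (Σ< m (λ s → Δf (k ℕ.+ s)) + Δf (k ℕ.+ m))               ∎
    where open ≡-Reasoning

  telescope-affine : ∀ (f Δf : ℕ → ℚ) → (∀ k → f (suc k) ≡ f k + Δf k) → ∀ p j k →
    f (suc k ℕ.* p ℕ.+ j) ≡ f (k ℕ.* p ℕ.+ j) + Σ< p (λ s → Δf (k ℕ.* p ℕ.+ (j ℕ.+ s)))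
  telescope-affine f Δf f≡ p j k = begin
    f (p ℕ.+ k ℕ.* p ℕ.+ j)        ≡⟨ cong f (trans (ℕ.+-assoc p (k ℕ.* p) j) (ℕ.+-comm p (k ℕ.* p ℕ.+ j))) ⟩
    f (k ℕ.* p ℕ.+ j ℕ.+ p)        ≡⟨ telescope f Δf f≡ (k ℕ.* p ℕ.+ j) p ⟩
    f (k ℕ.* p ℕ.+ j) + Σ< p (λ s → Δf (k ℕ.* p ℕ.+ j ℕ.+ s))
      ≡⟨ cong (f (k ℕ.* p ℕ.+ j) +_) (Σ<-cong p λ s _ → cong Δf (ℕ.+-assoc (k ℕ.* p) j s)) ⟩
    f (k ℕ.* p ℕ.+ j) + Σ< p (λ s → Δf (k ℕ.* p ℕ.+ (j ℕ.+ s)))   ∎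
    where open ≡-Reasoning

  -- The offset j is there for the induction: the difference of the progression is a sum of p
  -- progressions of `Δf`, with offsets j, ..., j + p - 1.
  absMonotone-affine : ∀ n {f} p j → AbsMonotone n f → AbsMonotone n (λ k → f (k ℕ.* p ℕ.+ j))
  absMonotone-affine zero    p j 0≤f k = 0≤f (k ℕ.* p ℕ.+ j)
  absMonotone-affine (suc n) {f} p j (0≤f , Δf , Δf-am , f≡) =
    (λ k → 0≤f (k ℕ.* p ℕ.+ j)) ,
    (λ k → Σ< p (λ s → Δf (k ℕ.* p ℕ.+ (j ℕ.+ s)))) ,
    absMonotone-Σ< n p (λ s → absMonotone-affine n p (j ℕ.+ s) Δf-am) ,
    telescope-affine f Δf f≡ p j

  -- f is increasing, and kp + j ≥ k because p ≥ 1.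
  affine-increasing : ∀ {f} p j .{{_ : NonZero p}} → AbsMonotone 1 f →
    ∀ k → 0ℚ ≤ f (k ℕ.* p ℕ.+ j) - f k
  affine-increasing {f} p j (_ , Δf , 0≤Δf , f≡) k
    with d , eq ← ℕ.m≤n⇒∃[o]m+o≡n (ℕ.≤-trans (ℕ.m≤m*n k p) (ℕ.m≤m+n (k ℕ.* p) j))
    = p≤q⇒0≤q-p (begin
      f k                                 ≡⟨ ℚ.+-identityʳ (f k) ⟨
      f k + 0ℚ                            ≤⟨ ℚ.+-monoʳ-≤ (f k) (Σ<-nonNeg d λ s → 0≤Δf (k ℕ.+ s)) ⟩
      f k + Σ< d (λ s → Δf (k ℕ.+ s))     ≡⟨ telescope f Δf f≡ k d ⟨
      f (k ℕ.+ d)                         ≡⟨ cong f eq ⟩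
      f (k ℕ.* p ℕ.+ j)                   ∎)
    where open ℚ.≤-Reasoning

  -- The difference of f (k p + j) − f k is (Δf (k p + j) − Δf k) + Σ_{0<s<p} Δf (k p + j + s):
  -- one summand of the same shape, and further ones that are dilations of Δf.
  absMonotone-affine-− : ∀ n {f} p j .{{_ : NonZero p}} → AbsMonotone (suc n) f →
    AbsMonotone n (λ k → f (k ℕ.* p ℕ.+ j) - f k)
  absMonotone-affine-− zero p j f-am = affine-increasing p j f-am
  absMonotone-affine-− (suc n) {f} p@(suc p-1) j (0≤f , Δf , Δf-am , f≡) =
    affine-increasing p j (0≤f , Δf , absMonotone-nonNeg (suc n) Δf-am , f≡) ,
    (λ k → (Δf (k ℕ.* p ℕ.+ (j ℕ.+ 0)) - Δf k) + rest k) ,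
    absMonotone-+ n
      -- The first summand is again a difference and uses up one order of `Δf`; the dilations keep
      -- the order, so theirs is lowered to match.
      (absMonotone-affine-− n p (j ℕ.+ 0) Δf-am)
      (absMonotone-Σ< n p-1 λ s → absMonotone-affine n p (j ℕ.+ suc s) (absMonotone-pred n Δf-am)) ,
    λ k → begin
      f (suc k ℕ.* p ℕ.+ j) - f (suc k)
        ≡⟨ cong₂ _-_ (trans (telescope-affine f Δf f≡ p j k)
             (cong (f (k ℕ.* p ℕ.+ j) +_) (Σ<-head (λ s → Δf (k ℕ.* p ℕ.+ (j ℕ.+ s))) p-1))) (f≡ k) ⟩
      (f (k ℕ.* p ℕ.+ j) + (Δf (k ℕ.* p ℕ.+ (j ℕ.+ 0)) + rest k)) - (f k + Δf k)
        ≡⟨ solve 5 (λ a b c d e → (a :+ (b :+ c)) :- (d :+ e) := (a :- d) :+ ((b :- e) :+ c)) refl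
             (f (k ℕ.* p ℕ.+ j)) (Δf (k ℕ.* p ℕ.+ (j ℕ.+ 0))) (rest k) (f k) (Δf k) ⟩
      (f (k ℕ.* p ℕ.+ j) - f k) + ((Δf (k ℕ.* p ℕ.+ (j ℕ.+ 0)) - Δf k) + rest k) ∎
    where
    open ≡-Reasoning
    open +-*-Solver
    rest : ℕ → ℚ
    rest k = Σ< p-1 (λ s → Δf (k ℕ.* p ℕ.+ (j ℕ.+ suc s)))

  convolve-− : ∀ i f g → convolve i (λ k → f k - g k) ≡ convolve i f - convolve i g
  convolve-− i f g = begin
    Σ< (suc i) (λ k → (f k - g k) * cofactor k i)
      ≡⟨ Σ<-cong (suc i) (λ k _ → solve 3 (λ a b c → (a :- b) :* c := a :* c :+ :- (b :* c)) refl
           (f k) (g k) (cofactor k i)) ⟩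
    Σ< (suc i) (λ k → f k * cofactor k i + - (g k * cofactor k i))
      ≡⟨ Σ<-+ (λ k → f k * cofactor k i) (λ k → - (g k * cofactor k i)) (suc i) ⟩
    convolve i f + Σ< (suc i) (λ k → - (g k * cofactor k i))
      ≡⟨ cong (convolve i f +_) (Σ<-neg (λ k → g k * cofactor k i) (suc i)) ⟩
    convolve i f - convolve i g ∎
    where
    open ≡-Reasoning
    open +-*-Solver

  -- All orders are assumed because each prime not dividing i replaces f by a difference, at the
  -- cost of one order.
  convolve-nonNeg : ∀ i .{{_ : NonZero i}} → ∀ f → (∀ n → AbsMonotone n f) → 0ℚ ≤ convolve i f
  convolve-nonNeg = prime-induction (λ i → ∀ f → (∀ n → AbsMonotone n f) → 0ℚ ≤ convolve i f)
    (λ f f-am → subst (0ℚ ≤_) (sym (convolve-1 f)) (f-am 0 1)) step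
    where
    step : ∀ {p} i .{{_ : NonZero i}} → Prime p →
      (∀ f → (∀ n → AbsMonotone n f) → 0ℚ ≤ convolve i f) →
      ∀ f → (∀ n → AbsMonotone n f) → 0ℚ ≤ convolve (i ℕ.* p) f
    step {p} i pp ih f f-am with p ∣? i
    ... | yes p∣i = subst (0ℚ ≤_) (sym (convolve-prime²* pp f i p∣i))
      (ih (λ k → f (k ℕ.* p)) λ n →
        absMonotone-resp n (λ k → cong f (ℕ.+-identityʳ (k ℕ.* p))) (absMonotone-affine n p 0 (f-am n)))
    ... | no p∤i  = subst (0ℚ ≤_)
      (trans (convolve-− i (λ k → f (k ℕ.* p)) f) (sym (convolve-prime* pp f i p∤i)))
      (ih (λ k → f (k ℕ.* p) - f k) λ n →
        absMonotone-resp n (λ k → cong (λ m → f m - f k) (ℕ.+-identityʳ (k ℕ.* p)))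
          (absMonotone-affine-− n p 0 {{prime⇒nonZero pp}} (f-am (suc n))))

  0≤^ : ∀ {r} → 0ℚ ≤ r → ∀ k → 0ℚ ≤ r ^ k
  0≤^ 0≤r zero    = ℚ.<⇒≤ (ℚ.positive⁻¹ 1ℚ)
  0≤^ 0≤r (suc k) = 0≤* 0≤r (0≤^ 0≤r k)

  -- The difference has the same shape with coefficient c (r - 1), which is nonnegative for r ≥ 1.
  absMonotone-^ : ∀ n {c r} → 0ℚ ≤ c → 1ℚ ≤ r → AbsMonotone n (λ k → c * r ^ k)
  absMonotone-^ zero    0≤c 1≤r k = 0≤* 0≤c (0≤^ (ℚ.≤-trans (ℚ.<⇒≤ (ℚ.positive⁻¹ 1ℚ)) 1≤r) k)
  absMonotone-^ (suc n) {c} {r} 0≤c 1≤r =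
    (λ k → 0≤* 0≤c (0≤^ (ℚ.≤-trans (ℚ.<⇒≤ (ℚ.positive⁻¹ 1ℚ)) 1≤r) k)) , (λ k → c * (r - 1ℚ) * r ^ k) ,
    absMonotone-^ n (0≤* 0≤c (p≤q⇒0≤q-p 1≤r)) 1≤r ,
    λ k → solve 3 (λ c r s → c :* (r :* s) := c :* s :+ c :* (r :- con 1ℚ) :* s) refl c r (r ^ k)
    where open +-*-Solver

  absMonotone-geometric : ∀ n {c r} → 0ℚ ≤ c → 1ℚ ≤ r → AbsMonotone n (λ k → Σ< k (λ t → c * r ^ t))
  -- The differences are the powers themselves. Building order n + 1 and lowering it treats n = 0
  -- uniformly.
  absMonotone-geometric n 0≤c 1≤r = absMonotone-pred n
    ((λ k → Σ<-nonNeg k (absMonotone-^ 0 0≤c 1≤r)) , _ , absMonotone-^ n 0≤c 1≤r , λ k → refl)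

  -- Sums of Mertens values

  mertens : ℕ → ℚ
  mertens n = Σ< n (mob ∘ suc)

  [r+q*k]/k≡q : ∀ {r} q k .{{_ : NonZero k}} → r ℕ.< k → (r ℕ.+ q ℕ.* k) / k ≡ q
  [r+q*k]/k≡q {r} q k r<k = trans (+-distrib-/-∣ʳ r (n∣m*n q))
    (cong₂ ℕ._+_ (m<n⇒m/n≡0 r<k) (m*n/n≡m q k))

  -- Passing from n to n + 1 raises the floor of n/k only when k divides n + 1, and then the new
  -- summand is μ((n + 1)/k).
  mertens-/-suc : ∀ n k .{{_ : NonZero k}} →
    mertens (suc n / k) ≡ mertens (n / k) + cofactor k (suc n)
  mertens-/-suc n k with ℕ.m≤n⇒m<n∨m≡n (m%n<n n k)
  ... | inj₁ 1+r<k = trans (cong mertens suc/)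
    (sym (trans (cong (mertens q +_) (cofactor-∤ k∤)) (ℚ.+-identityʳ (mertens q))))
    where
    q = n / k
    suc-n : suc n ≡ suc (n % k) ℕ.+ q ℕ.* k
    suc-n = cong suc (m≡m%n+[m/n]*n n k)
    suc/ : suc n / k ≡ q
    suc/ = trans (cong (_/ k) suc-n) ([r+q*k]/k≡q q k 1+r<k)
    k∤ : k ∤ suc n
    k∤ k∣ = ℕ.<⇒≱ 1+r<k (∣⇒≤ (∣m+n∣m⇒∣n
      (subst (k ∣_) (trans suc-n (ℕ.+-comm (suc (n % k)) (q ℕ.* k))) k∣) (n∣m*n q)))
  ... | inj₂ 1+r≡k = trans (cong mertens (trans (cong (_/ k) suc-n) (m*n/n≡m (suc q) k)))
    (cong (mertens q +_) (sym (cofactor-quotient (suc q) suc-n)))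
    where
    q = n / k
    suc-n : suc n ≡ suc q ℕ.* k
    suc-n = trans (cong suc (m≡m%n+[m/n]*n n k)) (cong (ℕ._+ q ℕ.* k) 1+r≡k)

  -- Induction on n: by `mertens-/-suc` the increments of the weights add up to (μ ∗ f)(n + 1).
  Σ<-mertens : ∀ f n →
    Σ< n (λ j → mertens (n / suc j) * f (suc j)) ≡ Σ< n (λ i → convolve (suc i) f)
  Σ<-mertens f zero    = refl
  Σ<-mertens f (suc n) = begin
    Σ< (suc n) (λ j → mertens (suc n / suc j) * f (suc j))
      ≡⟨ Σ<-cong (suc n) (λ j _ → trans (cong (_* f (suc j)) (mertens-/-suc n (suc j)))
           (solve 3 (λ a b c → (a :+ b) :* c := a :* c :+ c :* b) refl
             (mertens (n / suc j)) (cofactor (suc j) (suc n)) (f (suc j)))) ⟩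
    Σ< (suc n) (λ j → mertens (n / suc j) * f (suc j) + f (suc j) * cofactor (suc j) (suc n))
      ≡⟨ Σ<-+ (λ j → mertens (n / suc j) * f (suc j)) (λ j → f (suc j) * cofactor (suc j) (suc n)) (suc n) ⟩
    Σ< (suc n) (λ j → mertens (n / suc j) * f (suc j)) + Σ< (suc n) (λ j → f (suc j) * cofactor (suc j) (suc n))
      ≡⟨ cong₂ _+_ last-zero head-zero ⟩
    Σ< n (λ i → convolve (suc i) f) + convolve (suc n) f ∎
    where
    open ≡-Reasoning
    open +-*-Solver
    -- The new index j = n contributes nothing, since the floor of n/(n + 1) is 0 and the empty
    -- Mertens sum is 0.
    last-zero : Σ< (suc n) (λ j → mertens (n / suc j) * f (suc j)) ≡ Σ< n (λ i → convolve (suc i) f)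
    last-zero = begin
      Σ< n (λ j → mertens (n / suc j) * f (suc j)) + mertens (n / suc n) * f (suc n)
        ≡⟨ cong₂ (λ s q → s + mertens q * f (suc n)) (Σ<-mertens f n) (m<n⇒m/n≡0 (ℕ.n<1+n n)) ⟩
      Σ< n (λ i → convolve (suc i) f) + 0ℚ * f (suc n)
        ≡⟨ cong (Σ< n (λ i → convolve (suc i) f) +_) (ℚ.*-zeroˡ (f (suc n))) ⟩
      Σ< n (λ i → convolve (suc i) f) + 0ℚ
        ≡⟨ ℚ.+-identityʳ _ ⟩
      Σ< n (λ i → convolve (suc i) f) ∎
    head-zero : Σ< (suc n) (λ j → f (suc j) * cofactor (suc j) (suc n)) ≡ convolve (suc n) f
    head-zero = sym (begin
      convolve (suc n) f
        ≡⟨ Σ<-head (λ k → f k * cofactor k (suc n)) (suc n) ⟩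
      f 0 * cofactor 0 (suc n) + Σ< (suc n) (λ j → f (suc j) * cofactor (suc j) (suc n))
        ≡⟨ cong (λ c → f 0 * c + Σ< (suc n) (λ j → f (suc j) * cofactor (suc j) (suc n)))
             (cofactor-∤ {0} {suc n} (λ 0∣ → contradiction (0∣⇒≡0 0∣) λ ())) ⟩
      f 0 * 0ℚ + Σ< (suc n) (λ j → f (suc j) * cofactor (suc j) (suc n))
        ≡⟨ trans (cong (_+ Σ< (suc n) (λ j → f (suc j) * cofactor (suc j) (suc n))) (ℚ.*-zeroʳ (f 0)))
             (ℚ.+-identityˡ _) ⟩
      Σ< (suc n) (λ j → f (suc j) * cofactor (suc j) (suc n)) ∎)

  -- The Möbius function convolved with a constant vanishes beyond 1, so only i = 1 remains.
  Σ<-mertens-constant : ∀ n .{{_ : NonZero n}} c → Σ< n (λ j → mertens (n / suc j) * c) ≡ c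
  Σ<-mertens-constant n@(suc m) c = begin
    Σ< n (λ j → mertens (n / suc j) * c)
      ≡⟨ Σ<-mertens (λ _ → c) n ⟩
    Σ< n (λ i → convolve (suc i) (λ _ → c))
      ≡⟨ Σ<-support {n = n} (s≤s z≤n) (λ i 1≤i _ → convolve-constant (suc i) (s≤s 1≤i) c) ⟩
    0ℚ + convolve 1 (λ _ → c)
      ≡⟨ trans (ℚ.+-identityˡ _) (convolve-1 (λ _ → c)) ⟩
    c ∎
    where open ≡-Reasoning

  -- The left-hand side at rational arguments

  geometric : ℚ → ℕ → ℚ
  geometric q m = Σ< (suc m) (q ^_)

  -- The left-hand side of the inequality at λ = q; the index k of the statement is `suc j`.
  combination : ℕ → ℚ → ℚ
  combination n q = geometric q n -
    Σ< (n ∸ 1) (λ j → mertens ((n ∸ 1) / suc j) * geometric q (n ∸ suc j))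

  -- The Mertens weights add up to 1, so the full geometric sum can be moved inside the weighted
  -- sum.
  combination-differences : ∀ n .{{_ : NonZero n}} q → combination (suc n) q ≡
    Σ< n (λ j → mertens (n / suc j) * (geometric q (suc n) - geometric q (n ∸ j)))
  combination-differences n q = sym (begin
    Σ< n (λ j → m j * (top - g j))
      ≡⟨ Σ<-cong n (λ j _ → solve 3 (λ a b c → a :* (b :- c) := a :* b :+ :- (a :* c)) refl
           (m j) top (g j)) ⟩
    Σ< n (λ j → m j * top + - (m j * g j))
      ≡⟨ Σ<-+ (λ j → m j * top) (λ j → - (m j * g j)) n ⟩
    Σ< n (λ j → m j * top) + Σ< n (λ j → - (m j * g j))
      ≡⟨ cong₂ _+_ (Σ<-mertens-constant n top) (Σ<-neg (λ j → m j * g j) n) ⟩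
    combination (suc n) q ∎)
    where
    open ≡-Reasoning
    open +-*-Solver
    top = geometric q (suc n)
    m g : ℕ → ℚ
    m j = mertens (n / suc j)
    g j = geometric q (n ∸ j)

  0^suc : ∀ k → 0ℚ ^ suc k ≡ 0ℚ
  0^suc k = ℚ.*-zeroˡ (0ℚ ^ k)

  -- Only exponent 0 contributes, by 0⁰ = 1. Hence all differences of geometric sums vanish at 0.
  geometric-0 : ∀ m → geometric 0ℚ m ≡ 1ℚ
  geometric-0 m = Σ<-support {0ℚ ^_} {1} {suc m} (s≤s z≤n) λ { (suc k) _ _ → 0^suc k }

  combination-0 : ∀ n .{{_ : NonZero n}} → combination (suc n) 0ℚ ≡ 0ℚ
  combination-0 n = trans (combination-differences n 0ℚ) (Σ<-zero n λ j _ →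
    trans (cong₂ (λ a b → mertens (n / suc j) * (a - b)) (geometric-0 (suc n)) (geometric-0 (n ∸ j)))
      (ℚ.*-zeroʳ (mertens (n / suc j))))

  -- With r = 1/q this writes the top k terms of the geometric sum as q^m (1 + r + ⋯ + r^(k-1)),
  -- which makes sense, and is absolutely monotone, for every k.
  geometric-top : ∀ {q r} → q * r ≡ 1ℚ → ∀ m k → k ℕ.≤ m →
    geometric q m - geometric q (m ∸ k) ≡ Σ< k (λ t → q ^ m * r ^ t)
  geometric-top {q} {r} qr≡1 m zero    _   = ℚ.+-inverseʳ (geometric q m)
  geometric-top {q} {r} qr≡1 m (suc k) k<m = begin
    geometric q m - geometric q (m ∸ suc k)
      ≡⟨ solve 3 (λ a b c → a :- b := (a :- (b :+ c)) :+ c) refl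
           (geometric q m) (geometric q (m ∸ suc k)) (q ^ suc (m ∸ suc k)) ⟩
    geometric q m - geometric q (suc (m ∸ suc k)) + q ^ suc (m ∸ suc k)
      ≡⟨ cong (λ e → geometric q m - geometric q e + q ^ e) (sym (ℕ.+-∸-assoc 1 k<m)) ⟩
    geometric q m - geometric q (m ∸ k) + q ^ (m ∸ k)
      ≡⟨ cong₂ _+_ (geometric-top qr≡1 m k (ℕ.<⇒≤ k<m)) (sym (cancel m k (ℕ.<⇒≤ k<m))) ⟩
    Σ< k (λ t → q ^ m * r ^ t) + q ^ m * r ^ k ∎
    where
    open ≡-Reasoning
    open +-*-Solver
    cancel : ∀ m k → k ℕ.≤ m → q ^ m * r ^ k ≡ q ^ (m ∸ k)
    cancel m       zero    _         = ℚ.*-identityʳ (q ^ m)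
    cancel (suc m) (suc k) (s≤s k≤m) = begin
      q * q ^ m * (r * r ^ k)
        ≡⟨ solve 4 (λ a b c d → a :* b :* (c :* d) := a :* c :* (b :* d)) refl q (q ^ m) r (r ^ k) ⟩
      q * r * (q ^ m * r ^ k)     ≡⟨ cong₂ _*_ qr≡1 (cancel m k k≤m) ⟩
      1ℚ * q ^ (m ∸ k)            ≡⟨ ℚ.*-identityˡ _ ⟩
      q ^ (m ∸ k)                 ∎

  -- The left-hand side is the sum of (μ ∗ F)(i) over 1 ≤ i ≤ n. All its terms are nonnegative, and
  -- the one at i = 1 is `F 1`, the power in question.
  ^≤combination-pos : ∀ n .{{_ : NonZero n}} q → 0ℚ < q → q ≤ 1ℚ → q ^ suc n ≤ combination (suc n) q
  ^≤combination-pos n@(suc n-1) q 0<q q≤1 = begin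
    c
      ≡⟨ trans (convolve-1 F) (trans (ℚ.+-identityˡ (c * 1ℚ)) (ℚ.*-identityʳ c)) ⟨
    convolve 1 F                                 ≡⟨ ℚ.+-identityʳ (convolve 1 F) ⟨
    convolve 1 F + 0ℚ                            ≤⟨ ℚ.+-monoʳ-≤ (convolve 1 F) (Σ<-nonNeg n-1 λ i →
      convolve-nonNeg (suc (suc i)) F λ m → absMonotone-geometric m (0≤^ (ℚ.<⇒≤ 0<q) (suc n)) 1≤r) ⟩
    convolve 1 F + Σ< n-1 (λ i → convolve (suc (suc i)) F)
                                                 ≡⟨ Σ<-head (λ i → convolve (suc i) F) n-1 ⟨
    Σ< n (λ i → convolve (suc i) F)              ≡⟨ Σ<-mertens F n ⟨
    Σ< n (λ j → mertens (n / suc j) * F (suc j))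
      ≡⟨ Σ<-cong n (λ j j<n → cong (mertens (n / suc j) *_)
           (geometric-top (ℚ.*-inverseʳ q) (suc n) (suc j) (s≤s (ℕ.<⇒≤ j<n)))) ⟨
    Σ< n (λ j → mertens (n / suc j) * (geometric q (suc n) - geometric q (n ∸ j)))
                                                 ≡⟨ combination-differences n q ⟨
    combination (suc n) q                        ∎
    where
    open ℚ.≤-Reasoning
    instance
      q>0 : ℚ.Positive q
      q>0 = ℚ.positive 0<q
      q≢0 : ℚ.NonZero q
      q≢0 = ℚ.pos⇒nonZero q
    r c : ℚ
    r = 1/ q
    c = q ^ suc n
    F : ℕ → ℚ
    F k = Σ< k (λ t → c * r ^ t)
    1≤r : 1ℚ ≤ r
    1≤r = ℚ.*-cancelʳ-≤-pos q (subst₂ _≤_ (sym (ℚ.*-identityˡ q)) (sym (ℚ.*-inverseˡ q)) q≤1)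

  ^≤combination : ∀ n .{{_ : NonZero n}} q → 0ℚ ≤ q → q ≤ 1ℚ → q ^ suc n ≤ combination (suc n) q
  ^≤combination n q 0≤q q≤1 with q ℚ.≟ 0ℚ
  -- There is no inverse at 0, but both sides vanish there.
  ... | yes refl = ℚ.≤-reflexive (trans (0^suc n) (sym (combination-0 n)))
  ... | no q≢0   = ^≤combination-pos n q (ℚ.≰⇒> λ q≤0 → q≢0 (ℚ.≤-antisym q≤0 0≤q)) q≤1

  -- Lipschitz functions

  2ℚ : ℚ
  2ℚ = 1ℚ + 1ℚ

  0≤1 : 0ℚ ≤ 1ℚ
  0≤1 = ℚ.<⇒≤ (ℚ.positive⁻¹ 1ℚ)

  *-mono-≤ : ∀ {p q r s} → 0ℚ ≤ q → 0ℚ ≤ r → p ≤ q → r ≤ s → p * r ≤ q * s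
  *-mono-≤ {p} {q} {r} {s} 0≤q 0≤r p≤q r≤s = ℚ.≤-trans
    (ℚ.*-monoʳ-≤-nonNeg r {{ℚ.nonNegative 0≤r}} p≤q)
    (ℚ.*-monoˡ-≤-nonNeg q {{ℚ.nonNegative 0≤q}} r≤s)

  -- On [−2, 2], which contains every rational within distance 1 of [0, 1].
  record Lipschitz (f : ℚ → ℚ) : Set where
    field
      bound constant : ℚ
      0≤constant     : 0ℚ ≤ constant
      bounded        : ∀ {a} → ∣ a ∣ ≤ 2ℚ → ∣ f a ∣ ≤ bound
      lipschitz      : ∀ {a b} → ∣ a ∣ ≤ 2ℚ → ∣ b ∣ ≤ 2ℚ → ∣ f a - f b ∣ ≤ constant * ∣ a - b ∣

  open Lipschitz

  0≤bound : ∀ {f} (L : Lipschitz f) → 0ℚ ≤ bound L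
  0≤bound {f} L = ℚ.≤-trans (ℚ.0≤∣p∣ (f 0ℚ)) (bounded L (toWitness {a? = ∣ 0ℚ ∣ ℚ.≤? 2ℚ} _))

  lipschitz-const : ∀ c → Lipschitz (λ _ → c)
  lipschitz-const c = record
    { bound      = ∣ c ∣
    ; constant   = 0ℚ
    ; 0≤constant = ℚ.≤-refl
    ; bounded    = λ _ → ℚ.≤-refl
    ; lipschitz  = λ {a} {b} _ _ → ℚ.≤-reflexive
        (trans (cong ∣_∣ (ℚ.+-inverseʳ c)) (sym (ℚ.*-zeroˡ ∣ a - b ∣)))
    }

  lipschitz-id : Lipschitz (λ a → a)
  lipschitz-id = record
    { bound      = 2ℚ
    ; constant   = 1ℚ
    ; 0≤constant = 0≤1
    ; bounded    = λ a≤2 → a≤2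
    ; lipschitz  = λ {a} {b} _ _ → ℚ.≤-reflexive (sym (ℚ.*-identityˡ ∣ a - b ∣))
    }

  lipschitz-+ : ∀ {f g} → Lipschitz f → Lipschitz g → Lipschitz (λ a → f a + g a)
  lipschitz-+ {f} {g} L K = record
    { bound      = bound L + bound K
    ; constant   = constant L + constant K
    ; 0≤constant = 0≤+ (0≤constant L) (0≤constant K)
    ; bounded    = λ {a} a≤2 →
        ℚ.≤-trans (ℚ.∣p+q∣≤∣p∣+∣q∣ (f a) (g a)) (ℚ.+-mono-≤ (bounded L a≤2) (bounded K a≤2))
    ; lipschitz  = λ {a} {b} a≤2 b≤2 → begin
        ∣ (f a + g a) - (f b + g b) ∣
          ≡⟨ cong ∣_∣ (solve 4 (λ p q r s → (p :+ q) :- (r :+ s) := (p :- r) :+ (q :- s)) refl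
               (f a) (g a) (f b) (g b)) ⟩
        ∣ (f a - f b) + (g a - g b) ∣
          ≤⟨ ℚ.∣p+q∣≤∣p∣+∣q∣ (f a - f b) (g a - g b) ⟩
        ∣ f a - f b ∣ + ∣ g a - g b ∣
          ≤⟨ ℚ.+-mono-≤ (lipschitz L a≤2 b≤2) (lipschitz K a≤2 b≤2) ⟩
        constant L * ∣ a - b ∣ + constant K * ∣ a - b ∣
          ≡⟨ ℚ.*-distribʳ-+ ∣ a - b ∣ (constant L) (constant K) ⟨
        (constant L + constant K) * ∣ a - b ∣ ∎
    }
    where
    open ℚ.≤-Reasoning
    open +-*-Solver

  -- The increment is f(a)(g(a) - g(b)) + g(b)(f(a) - f(b)); the outer factors are why `Lipschitz`
  -- also records a bound.
  lipschitz-* : ∀ {f g} → Lipschitz f → Lipschitz g → Lipschitz (λ a → f a * g a)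
  lipschitz-* {f} {g} L K = record
    { bound      = bound L * bound K
    ; constant   = bound L * constant K + bound K * constant L
    ; 0≤constant = 0≤+ (0≤* (0≤bound L) (0≤constant K)) (0≤* (0≤bound K) (0≤constant L))
    ; bounded    = λ {a} a≤2 → subst (_≤ bound L * bound K) (sym (ℚ.∣p*q∣≡∣p∣*∣q∣ (f a) (g a)))
        (*-mono-≤ (0≤bound L) (ℚ.0≤∣p∣ (g a)) (bounded L a≤2) (bounded K a≤2))
    ; lipschitz  = λ {a} {b} a≤2 b≤2 → begin
        ∣ f a * g a - f b * g b ∣
          ≡⟨ cong ∣_∣ (solve 4 (λ p q r s → p :* q :- r :* s := p :* (q :- s) :+ s :* (p :- r)) refl
               (f a) (g a) (f b) (g b)) ⟩
        ∣ f a * (g a - g b) + g b * (f a - f b) ∣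
          ≤⟨ ℚ.∣p+q∣≤∣p∣+∣q∣ (f a * (g a - g b)) (g b * (f a - f b)) ⟩
        ∣ f a * (g a - g b) ∣ + ∣ g b * (f a - f b) ∣
          ≡⟨ cong₂ _+_ (ℚ.∣p*q∣≡∣p∣*∣q∣ (f a) (g a - g b)) (ℚ.∣p*q∣≡∣p∣*∣q∣ (g b) (f a - f b)) ⟩
        ∣ f a ∣ * ∣ g a - g b ∣ + ∣ g b ∣ * ∣ f a - f b ∣
          ≤⟨ ℚ.+-mono-≤
               (*-mono-≤ (0≤bound L) (ℚ.0≤∣p∣ (g a - g b)) (bounded L a≤2) (lipschitz K a≤2 b≤2))
               (*-mono-≤ (0≤bound K) (ℚ.0≤∣p∣ (f a - f b)) (bounded K b≤2) (lipschitz L a≤2 b≤2)) ⟩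
        bound L * (constant K * ∣ a - b ∣) + bound K * (constant L * ∣ a - b ∣)
          ≡⟨ solve 5 (λ p q r s t → p :* (q :* t) :+ r :* (s :* t) := (p :* q :+ r :* s) :* t) refl
               (bound L) (constant K) (bound K) (constant L) ∣ a - b ∣ ⟩
        (bound L * constant K + bound K * constant L) * ∣ a - b ∣ ∎
    }
    where
    open ℚ.≤-Reasoning
    open +-*-Solver

  lipschitz-neg : ∀ {f} → Lipschitz f → Lipschitz (λ a → - f a)
  lipschitz-neg {f} L = record
    { bound      = bound L
    ; constant   = constant L
    ; 0≤constant = 0≤constant L
    ; bounded    = λ {a} a≤2 → subst (_≤ bound L) (sym (ℚ.∣-p∣≡∣p∣ (f a))) (bounded L a≤2)
    ; lipschitz  = λ {a} {b} a≤2 b≤2 → subst (_≤ constant L * ∣ a - b ∣)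
        (trans (sym (ℚ.∣-p∣≡∣p∣ (f a - f b))) (cong ∣_∣ (ℚ.neg-distrib-+ (f a) (- f b))))
        (lipschitz L a≤2 b≤2)
    }

  lipschitz-Σ< : ∀ {f : ℕ → ℚ → ℚ} n → (∀ k → Lipschitz (f k)) → Lipschitz (λ a → Σ< n (λ k → f k a))
  lipschitz-Σ< zero    L = lipschitz-const 0ℚ
  lipschitz-Σ< (suc n) L = lipschitz-+ (lipschitz-Σ< n L) (L n)

  lipschitz-^ : ∀ k → Lipschitz (_^ k)
  lipschitz-^ zero    = lipschitz-const 1ℚ
  lipschitz-^ (suc k) = lipschitz-* lipschitz-id (lipschitz-^ k)

  lipschitz-geometric : ∀ m → Lipschitz (λ q → geometric q m)
  lipschitz-geometric m = lipschitz-Σ< (suc m) lipschitz-^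

  lipschitz-combination : ∀ n → Lipschitz (combination n)
  lipschitz-combination n = lipschitz-+ (lipschitz-geometric n)
    (lipschitz-neg (lipschitz-Σ< (n ∸ 1) λ j →
      lipschitz-* (lipschitz-const (mertens ((n ∸ 1) / suc j))) (lipschitz-geometric (n ∸ suc j))))

  -- Rational approximations of the real expression

  module _ where
    open RawMonoidOps (RawRing.+-rawMonoid ℝ-rawRing) using (sum)
    module ℤSum = RawMonoidOps ℤ.+-0-rawMonoid

    ι-sum : ∀ n (f : ℕ → ℤ) → ι (ℤSum.sum {n} λ i → f (toℕ i)) ≡ Σ< n (ι ∘ f)
    ι-sum zero    f = refl
    ι-sum (suc n) f = trans (ι-+ (f 0) (ℤSum.sum {n} λ i → f (suc (toℕ i))))
      (trans (cong (ι (f 0) +_) (ι-sum n (f ∘ suc))) (sym (Σ<-head (ι ∘ f) n)))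

    ι-M : ∀ n → ι (M n) ≡ mertens n
    ι-M n = ι-sum n (λ k → μ (suc k))

    seq-sum : ∀ n (f : ℕ → ℝ) t → seq (sum {n} λ i → f (toℕ i)) t ≡ Σ< n (λ k → seq (f k) t)
    seq-sum zero    f t = refl
    seq-sum (suc n) f t = trans (cong (seq (f 0) t +_) (seq-sum n (f ∘ suc) t))
      (sym (Σ<-head (λ k → seq (f k) t) n))

    seq-∑₁ : ∀ n (f : (k : ℕ) .{{_ : NonZero k}} → ℝ) t →
      seq (∑₁ n f) t ≡ Σ< n (λ j → seq (f (suc j)) t)
    seq-∑₁ n f t = seq-sum n (λ j → f (suc j)) t

    seq-^ : ∀ x k t → seq (x ℝ.^ k) t ≡ seq x t ^ k
    seq-^ x zero    t = refl
    seq-^ x (suc k) t = cong (seq x t *_) (seq-^ x k t)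

    seq-geometric : ∀ x m t → seq (∑₀ m (λ j → x ℝ.^ j)) t ≡ geometric (seq x t) m
    seq-geometric x m t =
      trans (seq-sum (suc m) (λ j → x ℝ.^ j) t) (Σ<-cong (suc m) λ k _ → seq-^ x k t)

    -- The function is passed with an equation for the reason given at combination-sign.
    seq-∑₁-weighted : ∀ n x t (f : (k : ℕ) .{{_ : NonZero k}} → ℝ) →
      f ≡ (λ k → fromℤ (M ((n ∸ 1) / k)) ℝ.* ∑₀ (n ∸ k) (λ j → x ℝ.^ j)) →
      seq (∑₁ (n ∸ 1) f) t ≡
      Σ< (n ∸ 1) (λ j → mertens ((n ∸ 1) / suc j) * geometric (seq x t) (n ∸ suc j))
    seq-∑₁-weighted n x t f f≡ = trans (seq-∑₁ (n ∸ 1) f t) (Σ<-cong (n ∸ 1) λ j _ → seq-weighted f f≡ j)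
      where
      seq-weighted : ∀ (f : (k : ℕ) .{{_ : NonZero k}} → ℝ) →
        f ≡ (λ k → fromℤ (M ((n ∸ 1) / k)) ℝ.* ∑₀ (n ∸ k) (λ j → x ℝ.^ j)) →
        ∀ j → seq (f (suc j)) t ≡ mertens ((n ∸ 1) / suc j) * geometric (seq x t) (n ∸ suc j)
      seq-weighted f refl j = cong₂ _*_ (ι-M ((n ∸ 1) / suc j)) (seq-geometric x (n ∸ suc j) t)

    seq-combination : ∀ n x t →
      seq (∑₀ n (λ j → x ℝ.^ j) ℝ.-
        ∑₁ (n ∸ 1) (λ k → fromℤ (M ((n ∸ 1) / k)) ℝ.* ∑₀ (n ∸ k) (λ j → x ℝ.^ j))) t ≡
      combination n (seq x t)
    seq-combination n x t = cong₂ _-_ (seq-geometric x n t) (seq-∑₁-weighted n x t _ refl)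

  -- Passage to real numbers

  ∣p∣≤ : ∀ {p d} → p ≤ d → - p ≤ d → ∣ p ∣ ≤ d
  ∣p∣≤ {p} {d} p≤d -p≤d with ℚ.∣p∣≡p∨∣p∣≡-p p
  ... | inj₁ ∣p∣≡p  = subst (_≤ d) (sym ∣p∣≡p) p≤d
  ... | inj₂ ∣p∣≡-p = subst (_≤ d) (sym ∣p∣≡-p) -p≤d

  p≤∣p∣ : ∀ p → p ≤ ∣ p ∣
  p≤∣p∣ p with ℚ.≤-total 0ℚ p
  ... | inj₁ 0≤p = ℚ.≤-reflexive (sym (ℚ.0≤p⇒∣p∣≡p 0≤p))
  ... | inj₂ p≤0 = ℚ.≤-trans p≤0 (ℚ.0≤∣p∣ p)

  p≤q+∣q-p∣ : ∀ p q → p ≤ q + ∣ q - p ∣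
  p≤q+∣q-p∣ p q = begin
    p                      ≡⟨ solve 2 (λ a b → a := b :+ :- (b :- a)) refl p q ⟩
    q + - (q - p)          ≤⟨ ℚ.+-monoʳ-≤ q (p≤∣p∣ (- (q - p))) ⟩
    q + ∣ - (q - p) ∣      ≡⟨ cong (q +_) (ℚ.∣-p∣≡∣p∣ (q - p)) ⟩
    q + ∣ q - p ∣          ∎
    where
    open ℚ.≤-Reasoning
    open +-*-Solver

  -- The witness is q truncated to the unit interval: 0, q or 1. The hypotheses limit the overshoot
  -- on either side to δ.
  nearest : ∀ {q δ} → 0ℚ ≤ δ → 0ℚ ≤ q + δ → q ≤ 1ℚ + δ →
    ∃ λ c → 0ℚ ≤ c × c ≤ 1ℚ × ∣ q - c ∣ ≤ δ
  nearest {q} {δ} 0≤δ 0≤q+δ q≤1+δ with ℚ.≤-total 0ℚ q | ℚ.≤-total q 1ℚ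
  ... | inj₂ q≤0 | _ = 0ℚ , ℚ.≤-refl , 0≤1 , ∣p∣≤
    (subst (_≤ δ) (sym (ℚ.+-identityʳ q)) (ℚ.≤-trans q≤0 0≤δ))
    (subst₂ _≤_ (solve 1 (λ q → con 0ℚ :- q := :- (q :- con 0ℚ)) refl q)
      (solve 2 (λ q d → (q :+ d) :- q := d) refl q δ) (ℚ.+-monoˡ-≤ (- q) 0≤q+δ))
    where open +-*-Solver
  ... | inj₁ 0≤q | inj₁ q≤1 = q , 0≤q , q≤1 , subst (λ d → ∣ d ∣ ≤ δ) (sym (ℚ.+-inverseʳ q)) 0≤δ
  ... | inj₁ _   | inj₂ 1≤q = 1ℚ , 0≤1 , ℚ.≤-refl , ∣p∣≤
    (subst (q - 1ℚ ≤_) (solve 1 (λ d → (con 1ℚ :+ d) :- con 1ℚ := d) refl δ) (ℚ.+-monoˡ-≤ (- 1ℚ) q≤1+δ))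
    (ℚ.≤-trans (ℚ.neg-antimono-≤ (p≤q⇒0≤q-p 1≤q)) 0≤δ)
    where open +-*-Solver

  0<⊓ : ∀ {p q} → 0ℚ < p → 0ℚ < q → 0ℚ < p ⊓ q
  0<⊓ {p} {q} 0<p 0<q with ℚ.≤-total p q
  ... | inj₁ p≤q = subst (0ℚ <_) (sym (ℚ.p≤q⇒p⊓q≡p p≤q)) 0<p
  ... | inj₂ q≤p = subst (0ℚ <_) (sym (ℚ.p≥q⇒p⊓q≡q q≤p)) 0<q

  0<* : ∀ {p q} → 0ℚ < p → 0ℚ < q → 0ℚ < p * q
  0<* {p} {q} 0<p 0<q = ℚ.positive⁻¹ (p * q)
    {{ℚ.pos*pos⇒pos p {{ℚ.positive 0<p}} q {{ℚ.positive 0<q}}}}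

  0<^ : ∀ {p} → 0ℚ < p → ∀ n → 0ℚ < p ^ n
  0<^ 0<p zero    = ℚ.positive⁻¹ 1ℚ
  0<^ 0<p (suc n) = 0<* 0<p (0<^ 0<p n)

  ^-mono-< : ∀ {p q} → 0ℚ < p → p < q → ∀ n → p ^ suc n < q ^ suc n
  ^-mono-< {p} {q} 0<p p<q zero    = subst₂ _<_ (sym (ℚ.*-identityʳ p)) (sym (ℚ.*-identityʳ q)) p<q
  ^-mono-< {p} {q} 0<p p<q (suc n) = ℚ.<-trans
    (ℚ.*-monoˡ-<-pos (p ^ suc n) {{ℚ.positive (0<^ 0<p (suc n))}} p<q)
    (ℚ.*-monoʳ-<-pos q {{ℚ.positive (ℚ.<-trans 0<p p<q)}} (^-mono-< 0<p p<q n))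

  ^-cancel-≤ : ∀ {p q} → 0ℚ < q → ∀ n → p ^ suc n ≤ q ^ suc n → p ≤ q
  ^-cancel-≤ 0<q n pⁿ≤qⁿ = ℚ.≮⇒≥ λ q<p → ℚ.<-irrefl refl (ℚ.<-≤-trans (^-mono-< 0<q q<p n) pⁿ≤qⁿ)

  ½ε+½ε≡ε : ∀ ε → ½ * ε + ½ * ε ≡ ε
  ½ε+½ε≡ε ε = trans (sym (ℚ.*-distribʳ-+ ε ½ ½)) (ℚ.*-identityˡ ε)

  0<½* : ∀ {ε} → 0ℚ < ε → 0ℚ < ½ * ε
  0<½* = 0<* (ℚ.positive⁻¹ ½)

  -- Take the minimum of ε/(1 + C) and 1. The divisor 1 + C is positive even for C = 0 and dominates
  -- both 1 and C, which gives the last two bounds.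
  radius : ∀ {C ε} → 0ℚ ≤ C → 0ℚ < ε → ∃ λ δ → 0ℚ < δ × δ ≤ 1ℚ × δ ≤ ε × C * δ ≤ ε
  radius {C} {ε} 0≤C 0<ε = δ , 0<δ , ℚ.p⊓q≤q (1/ K * ε) 1ℚ ,
    ℚ.≤-trans (subst (_≤ K * δ) (ℚ.*-identityˡ δ) (scale 1≤K)) Kδ≤ε ,
    ℚ.≤-trans (scale C≤K) Kδ≤ε
    where
    K : ℚ
    K = 1ℚ + C
    1≤K : 1ℚ ≤ K
    1≤K = ℚ.+-monoʳ-≤ 1ℚ 0≤C
    C≤K : C ≤ K
    C≤K = subst (_≤ K) (ℚ.+-identityˡ C) (ℚ.+-monoˡ-≤ C 0≤1)
    instance
      K>0 : ℚ.Positive K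
      K>0 = ℚ.positive (ℚ.<-≤-trans (ℚ.positive⁻¹ 1ℚ) 1≤K)
      K≢0 : ℚ.NonZero K
      K≢0 = ℚ.pos⇒nonZero K
    δ : ℚ
    δ = 1/ K * ε ⊓ 1ℚ
    0<δ : 0ℚ < δ
    0<δ = 0<⊓ (0<* (ℚ.positive⁻¹ (1/ K) {{ℚ.1/pos⇒pos K}}) 0<ε) (ℚ.positive⁻¹ 1ℚ)
    scale : ∀ {a} → a ≤ K → a * δ ≤ K * δ
    scale = ℚ.*-monoʳ-≤-nonNeg δ {{ℚ.nonNegative (ℚ.<⇒≤ 0<δ)}}
    Kδ≤ε : K * δ ≤ ε
    Kδ≤ε = ℚ.≤-trans
      (ℚ.*-monoˡ-≤-nonNeg K {{ℚ.pos⇒nonNeg K}} (ℚ.p⊓q≤p (1/ K * ε) 1ℚ))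
      (ℚ.≤-reflexive (trans (sym (ℚ.*-assoc K (1/ K) ε))
        (trans (cong (_* ε) (ℚ.*-inverseʳ K)) (ℚ.*-identityˡ ε))))

  1≤2 : 1ℚ ≤ 2ℚ
  1≤2 = ℚ.+-monoʳ-≤ 1ℚ 0≤1

  -- Transfer of sign and equality case to a real argument

  module _ (P : ℚ → ℚ) (L : Lipschitz P) (P0≡0 : P 0ℚ ≡ 0ℚ) (n : ℕ)
           (^≤P : ∀ q → 0ℚ ≤ q → q ≤ 1ℚ → q ^ suc n ≤ P q) where

    private
      C : ℚ
      C = Lipschitz.constant L

    lipschitz-within : ∀ {q c δ} → ∣ q ∣ ≤ 2ℚ → ∣ c ∣ ≤ 2ℚ → ∣ q - c ∣ ≤ δ → ∣ P q - P c ∣ ≤ C * δ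
    lipschitz-within q≤2 c≤2 q-c≤δ = ℚ.≤-trans (Lipschitz.lipschitz L q≤2 c≤2)
      (ℚ.*-monoˡ-≤-nonNeg C {{ℚ.nonNegative (Lipschitz.0≤constant L)}} q-c≤δ)

    ^≤P-approx : ∀ {q δ} → 0ℚ ≤ δ → δ ≤ 1ℚ → 0ℚ ≤ q + δ → q ≤ 1ℚ + δ →
      ∃ λ c → 0ℚ ≤ c × ∣ q - c ∣ ≤ δ × c ^ suc n ≤ P q + C * δ
    ^≤P-approx {q} {δ} 0≤δ δ≤1 0≤q+δ q≤1+δ
      with c , 0≤c , c≤1 , q-c≤δ ← nearest 0≤δ 0≤q+δ q≤1+δ
      = c , 0≤c , q-c≤δ , (begin
        c ^ suc n              ≤⟨ ^≤P c 0≤c c≤1 ⟩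
        P c                    ≤⟨ p≤q+∣q-p∣ (P c) (P q) ⟩
        P q + ∣ P q - P c ∣    ≤⟨ ℚ.+-monoʳ-≤ (P q) (lipschitz-within ∣q∣≤2 ∣c∣≤2 q-c≤δ) ⟩
        P q + C * δ            ∎)
      where
      open ℚ.≤-Reasoning
      open +-*-Solver
      ∣c∣≤1 : ∣ c ∣ ≤ 1ℚ
      ∣c∣≤1 = ℚ.≤-trans (ℚ.≤-reflexive (ℚ.0≤p⇒∣p∣≡p 0≤c)) c≤1
      ∣c∣≤2 : ∣ c ∣ ≤ 2ℚ
      ∣c∣≤2 = ℚ.≤-trans ∣c∣≤1 1≤2
      -- δ ≤ 1 keeps q in the region where the Lipschitz estimate holds.
      ∣q∣≤2 : ∣ q ∣ ≤ 2ℚ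
      ∣q∣≤2 = begin
        ∣ q ∣               ≡⟨ cong ∣_∣ (solve 2 (λ q c → q := (q :- c) :+ c) refl q c) ⟩
        ∣ (q - c) + c ∣     ≤⟨ ℚ.∣p+q∣≤∣p∣+∣q∣ (q - c) c ⟩
        ∣ q - c ∣ + ∣ c ∣   ≤⟨ ℚ.+-mono-≤ (ℚ.≤-trans q-c≤δ δ≤1) ∣c∣≤1 ⟩
        2ℚ                  ∎

    module _ (x y : ℝ) (seq-y : ∀ t → seq y t ≡ P (seq x t)) where

      -- The order on the reals only places the approximations eventually between -δ and 1 + δ,
      -- which is what `^≤P-approx` accepts.
      eventually-^≤P : 0ℝ ℝ.≤ x → x ℝ.≤ 1ℝ → ∀ δ → 0ℚ < δ → δ ≤ 1ℚ →
        ∃ λ N → ∀ t → N ℕ.≤ t →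
          ∃ λ c → 0ℚ ≤ c × ∣ seq x t - c ∣ ≤ δ × c ^ suc n ≤ P (seq x t) + C * δ
      eventually-^≤P 0≤x x≤1 δ 0<δ δ≤1 =
        let N₁ , lower = 0≤x δ 0<δ
            N₂ , upper = x≤1 δ 0<δ
        in N₁ ℕ.⊔ N₂ , λ t N≤t → ^≤P-approx (ℚ.<⇒≤ 0<δ) δ≤1
        (lower t (ℕ.m⊔n≤o⇒m≤o N₁ N₂ N≤t)) (upper t (ℕ.m⊔n≤o⇒n≤o N₁ N₂ N≤t))

      y-nonNeg : 0ℝ ℝ.≤ x → x ℝ.≤ 1ℝ → 0ℝ ℝ.≤ y
      y-nonNeg 0≤x x≤1 ε 0<ε =
        let δ , 0<δ , δ≤1 , _ , Cδ≤ε = radius (Lipschitz.0≤constant L) 0<ε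
            N , approx = eventually-^≤P 0≤x x≤1 δ 0<δ δ≤1
        in N , λ t N≤t → let c , 0≤c , _ , cⁿ≤ = approx t N≤t in begin
          0ℚ                     ≤⟨ 0≤^ 0≤c (suc n) ⟩
          c ^ suc n              ≤⟨ cⁿ≤ ⟩
          P (seq x t) + C * δ    ≤⟨ ℚ.+-monoʳ-≤ (P (seq x t)) Cδ≤ε ⟩
          P (seq x t) + ε        ≡⟨ cong (_+ ε) (seq-y t) ⟨
          seq y t + ε            ∎
        where open ℚ.≤-Reasoning

      -- When P(q) and the Lipschitz error are small, so is the power of the nearby point c; taking
      -- roots makes c small, and q is close to c.
      y≃0⇒x≃0 : 0ℝ ℝ.≤ x → x ℝ.≤ 1ℝ → y ≃ 0ℝ → x ≃ 0ℝ
      y≃0⇒x≃0 0≤x x≤1 y≃0 ε 0<ε =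
        let δ , 0<δ , δ≤1 , δ≤η⊓e , Cδ≤η⊓e = radius (Lipschitz.0≤constant L) (0<⊓ 0<η 0<e)
            N₁ , approx = eventually-^≤P 0≤x x≤1 δ 0<δ δ≤1
            N₂ , small = y≃0 η 0<η
        in N₁ ℕ.⊔ N₂ , λ t N≤t →
          let c , 0≤c , q-c≤δ , cⁿ≤ = approx t (ℕ.m⊔n≤o⇒m≤o N₁ N₂ N≤t)
              q = seq x t
              c≤e = ^-cancel-≤ 0<e n (begin
                c ^ suc n        ≤⟨ cⁿ≤ ⟩
                P q + C * δ      ≤⟨ ℚ.+-mono-≤
                  (begin
                    P q                 ≤⟨ p≤∣p∣ (P q) ⟩
                    ∣ P q ∣             ≡⟨ cong ∣_∣ (trans (ℚ.+-identityʳ _) (seq-y t)) ⟨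
                    ∣ seq y t - 0ℚ ∣    ≤⟨ small t (ℕ.m⊔n≤o⇒n≤o N₁ N₂ N≤t) ⟩
                    η                   ∎)
                  (ℚ.≤-trans Cδ≤η⊓e (ℚ.p⊓q≤p η e)) ⟩
                η + η            ≡⟨ ½ε+½ε≡ε (e ^ suc n) ⟩
                e ^ suc n        ∎)
          in begin
            ∣ q - 0ℚ ∣           ≡⟨ cong ∣_∣ (solve 2 (λ q c → q :- con 0ℚ := (q :- c) :+ c) refl q c) ⟩
            ∣ (q - c) + c ∣      ≤⟨ ℚ.∣p+q∣≤∣p∣+∣q∣ (q - c) c ⟩
            ∣ q - c ∣ + ∣ c ∣    ≤⟨ ℚ.+-mono-≤
              (ℚ.≤-trans q-c≤δ (ℚ.≤-trans δ≤η⊓e (ℚ.p⊓q≤q η e)))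
              (subst (_≤ e) (sym (ℚ.0≤p⇒∣p∣≡p 0≤c)) c≤e) ⟩
            e + e                ≡⟨ ½ε+½ε≡ε ε ⟩
            ε                    ∎
        where
        open ℚ.≤-Reasoning
        open +-*-Solver
        -- ε is shared between the distance from q to c and c itself; `e ^ suc n` is shared between
        -- P(q) and the Lipschitz error.
        e η : ℚ
        e = ½ * ε
        η = ½ * e ^ suc n
        0<e : 0ℚ < e
        0<e = 0<½* 0<ε
        0<η : 0ℚ < η
        0<η = 0<½* (0<^ 0<e (suc n))

      -- Continuity at 0, where P vanishes.
      x≃0⇒y≃0 : x ≃ 0ℝ → y ≃ 0ℝ
      x≃0⇒y≃0 x≃0 ε 0<ε =
        let δ , 0<δ , δ≤1 , _ , Cδ≤ε = radius (Lipschitz.0≤constant L) 0<ε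
            N , small = x≃0 δ 0<δ
        in N , λ t N≤t → begin
          ∣ seq y t - 0ℚ ∣
            ≡⟨ cong₂ (λ a b → ∣ a - b ∣) (seq-y t) (sym P0≡0) ⟩
          ∣ P (seq x t) - P 0ℚ ∣
            ≤⟨ lipschitz-within {seq x t} {0ℚ} (∣q∣≤2 (small t N≤t) δ≤1)
                 (toWitness {a? = ∣ 0ℚ ∣ ℚ.≤? 2ℚ} _) (small t N≤t) ⟩
          C * δ
            ≤⟨ Cδ≤ε ⟩
          ε ∎
        where
        open ℚ.≤-Reasoning
        ∣q∣≤2 : ∀ {q δ} → ∣ q - 0ℚ ∣ ≤ δ → δ ≤ 1ℚ → ∣ q ∣ ≤ 2ℚ
        ∣q∣≤2 {q} {δ} q≤δ δ≤1 = ℚ.≤-trans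
          (subst (λ p → ∣ p ∣ ≤ δ) (ℚ.+-identityʳ q) q≤δ) (ℚ.≤-trans δ≤1 1≤2)

  -- The expression enters through an equation, and is inferred from it below: comparing two
  -- elaborations of it would make Agda unfold and compare the Cauchy proofs, which is infeasible.
  combination-sign : ∀ n → 2 ℕ.≤ n → ∀ x y →
    y ≡ ∑₀ n (λ j → x ℝ.^ j) ℝ.-
      ∑₁ (n ∸ 1) (λ k → fromℤ (M ((n ∸ 1) / k)) ℝ.* ∑₀ (n ∸ k) (λ j → x ℝ.^ j)) →
    0ℝ ℝ.≤ x → x ℝ.≤ 1ℝ → 0ℝ ℝ.≤ y × (y ≃ 0ℝ ⇔ x ≃ 0ℝ)
  -- From here on n denotes one less than the n of the statement and is nonzero.
  combination-sign (suc n@(suc _)) (s≤s (s≤s z≤n)) x y y≡ 0≤x x≤1 =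
      y-nonNeg P L P0≡0 n ^≤P x y seq-y 0≤x x≤1
    , mk⇔ (y≃0⇒x≃0 P L P0≡0 n ^≤P x y seq-y 0≤x x≤1) (x≃0⇒y≃0 P L P0≡0 n ^≤P x y seq-y)
    where
    P     = combination (suc n)
    L     = lipschitz-combination (suc n)
    P0≡0  = combination-0 n
    ^≤P   = ^≤combination n
    seq-y : ∀ t → seq y t ≡ P (seq x t)
    seq-y t = trans (cong (λ z → seq z t) y≡) (seq-combination (suc n) x t)

open import Defs

theorem1p1 : (n : ℕ) → 2 ℕ.≤ n → (x : ℝ) → 0ℝ ≤ x → x ≤ 1ℝ →
    let P = (∑[ j =0⋯ n ] (x ^ j)) - (∑[ k =1⋯ (n ∸ 1) ] (fromℤ (M ((n ∸ 1) / k)) * (∑[ j =0⋯ (n ∸ k) ] (x ^ j))))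
    in (0ℝ ≤ P) × ((P ≃ 0ℝ) ⇔ (x ≃ 0ℝ))
theorem1p1 n 2≤n x 0≤x x≤1 =
  let signs = combination-sign n 2≤n x _ refl 0≤x x≤1
  in signs
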